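{- Let $n,r$ be positive integers and let $A,B,C$ be nonempty pairwise disjoint subsets of $[n]$ with $A\cup B\cup C=[n]$ and $|C|=r$. Then $$\big[(A\cup B\mid C)\big]_r=\sum_{S\subseteq C}(-1)^{|S|}\big[(A\cup S\mid B\cup(C\setminus S))\big]_r.$$
   Context: An ordered set partition of $[n]$ with $d$ blocks is a sequence $\pi=(\pi_1\mid\cdots\mid\pi_d)$ of nonempty pairwise disjoint subsets of $[n]$ with union $[n]$; $\mathcal{OP}(n,d,r)$ is the set of those with every block of size at least $r$. Let $M=(x_{ij})_{1\le i,j\le n}$ be an $n\times n$ matrix of distinct indeterminates; $M_I^J$ is the determinant of the submatrix with rows $I$ and columns $J$ (both increasing). For $\pi\in\mathcal{OP}(n,d,r)$, an $r$-jellyfish tableau for $\pi$ is an array $T$ with $n-(d-1)r$ rows and $d$ columns, cells empty or containing elements of $[n]$, such that all cells in rows $1,\dots,r$ are nonempty, each row $i>r$ has exactly one nonempty cell, and the nonempty entries of column $j$ are exactly $\pi_j$, increasing downward; $\mathcal{J}_r(\pi)$ is their set. $\mathrm{sgn}(T)=(-1)^{\mathrm{inv}(T)}$, $\mathrm{inv}(T)$ being the number of inversions of the row reading word (rows left to right, top to bottom, empty cells skipped). $\mathrm{J}(T)=\prod_jM^{\pi_j}_{R_j(T)}$ with $R_j(T)$ the set of rows in which column $j$ is nonempty, and the $r$-jellyfish invariant is $[\pi]_r=\sum_{T\in\mathcal{J}_r(\pi)}\mathrm{sgn}(T)\mathrm{J}(T)$. If an ordered set partition has a block of size less than $r$ (or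 an empty block), its $r$-jellyfish invariant is defined to be $0$. -}

module Defs where

open import Level using (Level)
open import Data.Bool using (Bool; true; false; if_then_else_; not; _∧_)
open import Data.Nat as ℕ using (ℕ; zero; suc; _∸_; _<ᵇ_; _≡ᵇ_; _<_)
open import Data.Fin as Fin using (Fin; toℕ)
open import Data.Fin.Subset using (Subset; inside; outside; ∣_∣)
open import Data.Vec as Vec using (Vec; []; _∷_)
open import Data.List as List using (List; []; _∷_; _++_; [_]; concatMap; filter; map; length)
open import Data.Product using (_×_; _,_; proj₁; proj₂)
open import Data.Maybe using (Maybe; just; nothing)
open import Data.Nat.Properties using (_≤?_)
open import Relation.Nullary.Decidable using (⌊_⌋)
open import Algebra.Bundles using (CommutativeRing)

elems : ∀ {n} → Subset n → List (Fin n)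
elems []              = []
elems (inside  ∷ p)   = Fin.zero ∷ map Fin.suc (elems p)
elems (outside ∷ p)   = map Fin.suc (elems p)

subsetsOf : ∀ {n} → Subset n → List (Subset n)
subsetsOf []            = [ [] ]
subsetsOf (inside  ∷ c) = concatMap (λ s → (outside ∷ s) ∷ (inside ∷ s) ∷ []) (subsetsOf c)
subsetsOf (outside ∷ c) = map (outside ∷_) (subsetsOf c)

allWords : ∀ {d} → ℕ → List (List (Fin d))
allWords {d} zero    = [ [] ]
allWords {d} (suc m) = concatMap (λ w → map (_∷ w) (List.allFin d)) (allWords m)

countOcc : ∀ {d} → Fin d → List (Fin d) → ℕ
countOcc j []       = 0
countOcc j (x ∷ xs) = (if toℕ x ≡ᵇ toℕ j then 1 else 0) ℕ.+ countOcc j xs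

inversions : ∀ {n} → List (Fin n) → ℕ
inversions []       = 0
inversions (x ∷ xs) = length (filter (λ y → toℕ y <? toℕ x) xs) ℕ.+ inversions xs
  where open import Data.Nat using (_<?_)

-- Rows of a tableau are 1..N (here 0-based: indices with toℕ < N),
-- viewed inside [n] (N ≤ n always, since N = n - (d-1) r).
rowsBelow : ∀ {n} → ℕ → List (Fin n)
rowsBelow {n} N = filter (λ i → toℕ i <? N) (List.allFin n)
  where open import Data.Nat using (_<?_)

rowsBetween : ∀ {n} → ℕ → ℕ → List (Fin n)
rowsBetween {n} lo hi = filter (λ i → lo ≤? toℕ i) (rowsBelow hi)

-- A jellyfish tableau for π = (π_1 | ... | π_d) (all |π_j| ≥ r) is
-- determined by the column in which the unique nonempty cell of each row
-- i > r lies.  We represent it by this list of columns ("lower"), subject to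
-- column j containing exactly |π_j| nonempty cells, i.e. |π_j| - r of the
-- lower rows.  The row set R_j(T) is {1..r} ∪ {lower rows assigned to j},
-- and the entries of column j are π_j written increasingly downward.

module _ {n d : ℕ} (r : ℕ) (π : Vec (Subset n) d) where

  numRows : ℕ
  numRows = n ∸ ((d ∸ 1) ℕ.* r)

  topRows : List (Fin n)
  topRows = rowsBelow r

  lowerRows : List (Fin n)
  lowerRows = rowsBetween r numRows

  validAssign : List (Fin d) → Bool
  validAssign a = List.foldr (λ j b → (countOcc j a ≡ᵇ (∣ Vec.lookup π j ∣ ∸ r)) ∧ b) true (List.allFin d)

  tableaux : List (List (Fin d))
  tableaux = filter (λ a → T? (validAssign a)) (allWords (length lowerRows))
    where open import Relation.Nullary.Decidable using (T?)
          open import Data.Bool using (T)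

  rowSet : List (Fin d) → Fin d → List (Fin n)
  rowSet a j = topRows ++ List.map proj₁
                 (filter (λ p → toℕ (proj₂ p) ℕ.≟ toℕ j) (List.zip lowerRows a))

  column : List (Fin d) → Fin d → List (Fin n × Fin n)
  column a j = List.zip (rowSet a j) (elems (Vec.lookup π j))

  entryAt : Fin n → List (Fin n × Fin n) → List (Fin n)
  entryAt i []             = []
  entryAt i ((k , e) ∷ ps) = if toℕ k ≡ᵇ toℕ i then e ∷ [] else entryAt i ps

  readingWord : List (Fin d) → List (Fin n)
  readingWord a = concatMap (λ i → concatMap (λ j → entryAt i (column a j)) (List.allFin d))
                            (rowsBelow numRows)

  bigBlocks : Bool
  bigBlocks = Vec.foldr (λ _ → Bool) (λ p b → if (r ℕ.≤ᵇ ∣ p ∣) then b else false) true π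

module Jelly {c ℓ : Level} (R : CommutativeRing c ℓ) where
  open CommutativeRing R

  sum : List Carrier → Carrier
  sum = List.foldr _+_ 0#

  prod : List Carrier → Carrier
  prod = List.foldr _*_ 1#

  signPow : ℕ → Carrier
  signPow zero          = 1#
  signPow (suc zero)    = - 1#
  signPow (suc (suc k)) = signPow k

  module _ {n : ℕ} (M : Fin n → Fin n → Carrier) where

    -- M_I^J : determinant of the submatrix of M with rows I and columns J
    -- (I, J increasing lists of equal length), by Laplace expansion along
    -- the first row.
    minor : List (Fin n) → List (Fin n) → Carrier
    minor []       []      = 1#
    minor []       (_ ∷ _) = 0#
    minor (i ∷ is) cols    = go [] cols 0
      where
      go : List (Fin n) → List (Fin n) → ℕ → Carrier
      go pre []         k = 0#
      go pre (x ∷ post) k = signPow k * M i x * minor is (pre ++ post)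
                            + go (pre ++ [ x ]) post (suc k)

    jellyfish : ∀ {d} → (r : ℕ) → Vec (Subset n) d → Carrier
    jellyfish {d} r π =
      if bigBlocks r π
      then sum (map (λ a → signPow (inversions (readingWord r π a))
                           * prod (map (λ j → minor (rowSet r π a j) (elems (Vec.lookup π j)))
                                       (List.allFin d)))
                    (tableaux r π))
      else 0#

module Submission where

-- Expanding every minor row by row turns [π]_r into a signed sum
-- over all fillings of the rows by [n] in which each of the first r rows holds
-- one element of each block and every other row holds one element of any block;
-- the sign is that of the row reading word.  The alternating sum over S ⊆ C
-- then gives each c ∈ C the formal colour (block 2) − (block 1).  This colour
-- contributes 0 to a lower row, and two elements of C sharing one of the first
-- r rows cancel by antisymmetry, so the r elements of C occupy the first r rows
-- one by one, and their partner in A or B contributes exactly as for (A ∪ B ∣ C).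

open import Defs
open import Level using (Level)
open import Data.Bool using (Bool; true; false; T)
open import Data.Bool.Properties using (T-∧; T?)
open import Data.Empty using (⊥-elim)
open import Data.Fin as Fin using (Fin; toℕ)
open import Data.Fin.Patterns using (0F; 1F)
open import Data.Fin.Properties using (toℕ-injective)
open import Data.Fin.Subset
  using (Subset; inside; outside; ⊤; ⊥; _∪_; _∩_; _─_; ∣_∣; Nonempty)
open import Data.Fin.Subset.Properties using (∣p∣≤n)
open import Data.List as List using (List; []; _∷_; _++_; [_]; map; filter; length; concatMap; zip)
open import Data.List.Properties
  using (++-assoc; filter-none; filter-all; filter-accept; filter-reject; length-map; length-++; map-∘; map-id)
open import Data.List.Relation.Binary.Permutation.Propositional
  using (_↭_; ↭-refl; ↭-sym; ↭-trans; prep; swap)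
import Data.List.Relation.Binary.Permutation.Propositional.Properties as ↭
open import Data.List.Relation.Unary.All as All using (All; []; _∷_)
import Data.List.Relation.Unary.All.Properties as All
open import Data.List.Relation.Unary.AllPairs as AllPairs using (AllPairs; []; _∷_)
import Data.List.Relation.Unary.AllPairs.Properties as AllPairs
open import Data.Nat as ℕ using (ℕ; zero; suc; z≤n; s≤s; _≥_)
import Data.Nat.ListAction as ℕ
import Data.Nat.ListAction.Properties as ℕ
import Data.Nat.Properties as ℕ
open import Data.Product using (Σ; _×_; _,_; proj₁; proj₂)
open import Data.Unit using (tt)
open import Data.Vec as Vec using (Vec; []; _∷_)
open import Data.Vec.Properties using (∷-injectiveʳ)
open import Function using (_∘_; id; Equivalence)
open import Relation.Binary.Definitions using (tri<; tri≈; tri>)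
open import Relation.Binary.PropositionalEquality as ≡ using (_≡_; _≢_)
open import Relation.Nullary using (¬_; Dec; yes; no)
open import Algebra.Bundles using (CommutativeRing)

-- The signs decide whether a formal colour makes sense. A minor sees only positions inside its own
-- block, and these change when an element of `C` changes block. Transferring all signs to removals
-- from one common list of elements (`Pick`, `E`) makes them independent of the labels; the filling
-- sum is then linear in the label of each element, and a label may be replaced by a combination of
-- blocks. Size conditions would spoil this linearity, because they depend on the partition. They
-- are therefore never imposed on the filling sum: minors with unequal numbers of rows and columns
-- vanish, which removes the invalid assignments and also yields the value 0 prescribed for small
-- blocks. The ring is arbitrary, so a sum equal to its own negative need not be 0; antisymmetric
-- terms have to be cancelled in pairs. The partner of `c` in a top row contributes as claimed for
-- this reason: an element of `A` stays in block 1 on both sides, while an element of `B` trades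
-- places with `c` on the right, and the coefficient -1 of `c` in block 1 is offset by the sign of
-- that transposition.

-- Two-column shapes, shuffles and inversion counts

-- A list of pairs carrying a column in Fin 2 encodes either a shape (the cells in
-- reading order, paired with their rows) or a two-block partition (elements in
-- increasing order, paired with their blocks); part j selects column or block j.
part : ∀ {X : Set} → Fin 2 → List (X × Fin 2) → List X
part j s = map proj₁ (filter (λ p → toℕ (proj₂ p) ℕ.≟ toℕ j) s)

part-↭ : ∀ {X : Set} j {s t : List (X × Fin 2)} → s ↭ t → length (part j s) ≡ length (part j t)
part-↭ j s↭t = ↭.↭-length (↭.map⁺ proj₁ (↭.filter-↭ _ s↭t))

part-All : ∀ {X : Set} {P : X → Set} j {s : List (X × Fin 2)} → All (P ∘ proj₁) s → All P (part j s)
part-All j ps = All.map⁺ (All.filter⁺ _ ps)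

-- The inversion number of the sequence of columns, that is, the length of the shuffle that sorts
-- the list by column. It is the only sign information that a shape or a partition contributes.
crossings : ∀ {X : Set} → List (X × Fin 2) → ℕ
crossings []             = 0
crossings ((_ , 0F) ∷ s) = crossings s
crossings ((_ , 1F) ∷ s) = length (part 0F s) ℕ.+ crossings s

-- The shuffle of `ps` and `qs` prescribed by the columns of the shape. The clauses that skip a cell
-- whose list has run out only make the function total: the lemmas about it assume matching lengths.
fill : ∀ {X Y : Set} → List (X × Fin 2) → List Y → List Y → List Y
fill []             ps       qs       = []
fill ((_ , 0F) ∷ s) []       qs       = fill s [] qs
fill ((_ , 0F) ∷ s) (p ∷ ps) qs       = p ∷ fill s ps qs
fill ((_ , 1F) ∷ s) ps       []       = fill s ps []
fill ((_ , 1F) ∷ s) ps       (q ∷ qs) = q ∷ fill s ps qs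

fill-↭ : ∀ {X Y : Set} (s : List (X × Fin 2)) (ps qs : List Y) →
  length (part 0F s) ≡ length ps → length (part 1F s) ≡ length qs → fill s ps qs ↭ ps ++ qs
fill-↭ []             []       []       _  _  = ↭-refl
fill-↭ ((_ , 0F) ∷ s) (p ∷ ps) qs       e₀ e₁ = prep p (fill-↭ s ps qs (ℕ.suc-injective e₀) e₁)
fill-↭ ((_ , 1F) ∷ s) ps       (q ∷ qs) e₀ e₁ =
  ↭-trans (prep q (fill-↭ s ps qs e₀ (ℕ.suc-injective e₁))) (↭-sym (↭.shift q ps qs))

Increasing : ∀ {n} {K : Set} → List (Fin n × K) → Set
Increasing = AllPairs (λ x y → toℕ (proj₁ x) ℕ.< toℕ (proj₁ y))

disjoint-parts : ∀ {n} (w : List (Fin n × Fin 2)) → Increasing w →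
  All (λ q → All (q ≢_) (part 0F w)) (part 1F w)
disjoint-parts []             []        = []
disjoint-parts ((e , 0F) ∷ w) (e< ∷ w<) =
  All.zipWith (λ { (e<q , q∉) → (λ q≡e → ℕ.<-irrefl (≡.cong toℕ (≡.sym q≡e)) e<q) ∷ q∉ })
    (part-All 1F e< , disjoint-parts w w<)
disjoint-parts ((e , 1F) ∷ w) (e< ∷ w<) =
  All.map (λ e<p e≡p → ℕ.<-irrefl (≡.cong toℕ e≡p) e<p) (part-All 0F e<) ∷ disjoint-parts w w<

less : ∀ {n} → Fin n → List (Fin n) → ℕ
less x xs = length (filter (λ y → toℕ y ℕ.<? toℕ x) xs)

less-∷ : ∀ {n} (x y : Fin n) ys → less x (y ∷ ys) ≡ less x [ y ] ℕ.+ less x ys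
less-∷ x y ys with toℕ y ℕ.<ᵇ toℕ x
... | true  = ≡.refl
... | false = ≡.refl

less-yes : ∀ {n} (x y : Fin n) → toℕ y ℕ.< toℕ x → less x [ y ] ≡ 1
less-yes x y y<x = ≡.cong length (filter-accept (λ y → toℕ y ℕ.<? toℕ x) y<x)

less-no : ∀ {n} (x y : Fin n) → ¬ toℕ y ℕ.< toℕ x → less x [ y ] ≡ 0
less-no x y y≮x = ≡.cong length (filter-reject (λ y → toℕ y ℕ.<? toℕ x) y≮x)

less-↭ : ∀ {n} (x : Fin n) {xs ys} → xs ↭ ys → less x xs ≡ less x ys
less-↭ x xs↭ys = ↭.↭-length (↭.filter-↭ _ xs↭ys)

less-none : ∀ {n} (x : Fin n) {xs} → All (λ y → toℕ x ℕ.< toℕ y) xs → less x xs ≡ 0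
less-none x x< = ≡.cong length (filter-none _ (All.map (λ x<y y<x → ℕ.<-asym x<y y<x) x<))

-- Signs of shuffled words

module Signs {c ℓ : Level} (R : CommutativeRing c ℓ) where
  open CommutativeRing R
  open Jelly R
  open import Algebra.Properties.Ring ring using (-1*x≈-x; -‿involutive)
  open import Algebra.Solver.Ring.NaturalCoefficients.Default commutativeSemiring
    using (solve; _:*_; _:+_; _:=_)
  open import Relation.Binary.Reasoning.Setoid setoid

  -- The sign is an ordinary scalar, so that the semiring solver can treat it as a variable; `ε*ε`
  -- and `1+ε` are then applied by hand.
  ε : Carrier
  ε = - 1#

  ε*ε : ε * ε ≈ 1#
  ε*ε = trans (-1*x≈-x ε) (-‿involutive 1#)

  1+ε : 1# + ε ≈ 0#
  1+ε = -‿inverseʳ 1#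

  signPow-suc : ∀ k → signPow (suc k) ≈ ε * signPow k
  signPow-suc zero          = sym (*-identityʳ ε)
  signPow-suc (suc zero)    = sym ε*ε
  signPow-suc (suc (suc k)) = signPow-suc k

  signPow-+ : ∀ m k → signPow (m ℕ.+ k) ≈ signPow m * signPow k
  signPow-+ zero    k = sym (*-identityˡ _)
  signPow-+ (suc m) k = begin
    signPow (suc (m ℕ.+ k))      ≈⟨ signPow-suc (m ℕ.+ k) ⟩
    ε * signPow (m ℕ.+ k)        ≈⟨ *-congˡ (signPow-+ m k) ⟩
    ε * (signPow m * signPow k)  ≈⟨ *-assoc _ _ _ ⟨
    ε * signPow m * signPow k    ≈⟨ *-congʳ (signPow-suc m) ⟨
    signPow (suc m) * signPow k  ∎

  signPow² : ∀ m → signPow m * signPow m ≈ 1#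
  signPow² zero          = *-identityˡ 1#
  signPow² (suc zero)    = ε*ε
  signPow² (suc (suc m)) = signPow² m

  signPow-≡ : ∀ {m k} → m ≡ k → signPow m ≈ signPow k
  signPow-≡ m≡k = reflexive (≡.cong signPow m≡k)

  less-swap : ∀ {n} (p q : Fin n) → q ≢ p → signPow (less p [ q ]) ≈ ε * signPow (less q [ p ])
  less-swap p q q≢p with ℕ.<-cmp (toℕ q) (toℕ p)
  ... | tri< q<p _ p≮q = begin
    signPow (less p [ q ])      ≡⟨ ≡.cong signPow (less-yes p q q<p) ⟩
    ε                           ≈⟨ *-identityʳ ε ⟨
    ε * 1#                      ≡⟨ ≡.cong (λ k → ε * signPow k) (less-no q p p≮q) ⟨
    ε * signPow (less q [ p ])  ∎
  ... | tri≈ _ q≡p _ = ⊥-elim (q≢p (toℕ-injective q≡p))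
  ... | tri> q≮p _ p<q = begin
    signPow (less p [ q ])      ≡⟨ ≡.cong signPow (less-no p q q≮p) ⟩
    1#                          ≈⟨ ε*ε ⟨
    ε * ε                       ≡⟨ ≡.cong (λ k → ε * signPow k) (less-yes q p p<q) ⟨
    ε * signPow (less q [ p ])  ∎

  -- On its way to the front `q` passes every letter of `ps`, and each passage flips the parity
  -- because the letters differ. Once in front, `q` accounts for `less q (ps ++ qs)` inversions.
  sign-move : ∀ {n} (ps : List (Fin n)) q qs → All (q ≢_) ps →
    signPow (inversions (ps ++ q ∷ qs)) ≈
    signPow (length ps) * (signPow (less q (ps ++ qs)) * signPow (inversions (ps ++ qs)))
  sign-move []       q qs []          = trans (signPow-+ (less q qs) _) (sym (*-identityˡ _))
  sign-move (p ∷ ps) q qs (q≢p ∷ q∉ps) = begin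
    signPow (less p (ps ++ q ∷ qs) ℕ.+ inversions (ps ++ q ∷ qs))
      ≈⟨ signPow-+ (less p (ps ++ q ∷ qs)) _ ⟩
    signPow (less p (ps ++ q ∷ qs)) * signPow (inversions (ps ++ q ∷ qs))
      ≈⟨ *-cong (signPow-≡ (≡.trans (less-↭ p (↭.shift q ps qs)) (less-∷ p q (ps ++ qs))))
                (sign-move ps q qs q∉ps) ⟩
    signPow (less p [ q ] ℕ.+ less p (ps ++ qs)) * (k * (lq * i))
      ≈⟨ *-congʳ (trans (signPow-+ (less p [ q ]) _) (*-congʳ (less-swap p q q≢p))) ⟩
    (ε * x) * lp * (k * (lq * i))
      ≈⟨ solve 6 (λ ε x lp k lq i → (ε :* x) :* lp :* (k :* (lq :* i)) :=
                                    ε :* k :* ((x :* lq) :* (lp :* i))) refl ε x lp k lq i ⟩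
    ε * k * ((x * lq) * (lp * i))
      ≈⟨ *-cong (signPow-suc (length ps)) (*-cong
           (trans (signPow-≡ (less-∷ q p (ps ++ qs))) (signPow-+ (less q [ p ]) _))
           (signPow-+ (less p (ps ++ qs)) _)) ⟨
    signPow (suc (length ps)) * (signPow (less q (p ∷ ps ++ qs)) * signPow (less p (ps ++ qs) ℕ.+ inversions (ps ++ qs)))
      ∎
    where
    x  = signPow (less q [ p ])
    lp = signPow (less p (ps ++ qs))
    lq = signPow (less q (ps ++ qs))
    k  = signPow (length ps)
    i  = signPow (inversions (ps ++ qs))

  sign-fill : ∀ {X : Set} {n} (s : List (X × Fin 2)) (ps qs : List (Fin n)) →
    length (part 0F s) ≡ length ps → length (part 1F s) ≡ length qs →
    All (λ q → All (q ≢_) ps) qs →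
    signPow (inversions (fill s ps qs)) ≈ signPow (crossings s) * signPow (inversions (ps ++ qs))
  sign-fill [] [] [] _ _ _ = sym (*-identityˡ _)
  sign-fill ((_ , 0F) ∷ s) (p ∷ ps) qs e₀ e₁ dis = begin
    signPow (less p (fill s ps qs) ℕ.+ inversions (fill s ps qs))
      ≈⟨ signPow-+ (less p (fill s ps qs)) _ ⟩
    signPow (less p (fill s ps qs)) * signPow (inversions (fill s ps qs))
      ≈⟨ *-cong (signPow-≡ (less-↭ p (fill-↭ s ps qs e₀′ e₁)))
                (sign-fill s ps qs e₀′ e₁ (All.map All.tail dis)) ⟩
    l * (cr * i)
      ≈⟨ solve 3 (λ l c i → l :* (c :* i) := c :* (l :* i)) refl l cr i ⟩
    cr * (l * i)
      ≈⟨ *-congˡ (signPow-+ (less p (ps ++ qs)) _) ⟨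
    cr * signPow (less p (ps ++ qs) ℕ.+ inversions (ps ++ qs))
      ∎
    where
    e₀′ = ℕ.suc-injective e₀
    l  = signPow (less p (ps ++ qs))
    cr = signPow (crossings s)
    i  = signPow (inversions (ps ++ qs))
  sign-fill ((_ , 1F) ∷ s) ps (q ∷ qs) e₀ e₁ (q∉ps ∷ dis) = begin
    signPow (less q (fill s ps qs) ℕ.+ inversions (fill s ps qs))
      ≈⟨ signPow-+ (less q (fill s ps qs)) _ ⟩
    signPow (less q (fill s ps qs)) * signPow (inversions (fill s ps qs))
      ≈⟨ *-cong (signPow-≡ (less-↭ q (fill-↭ s ps qs e₀ e₁′)))
                (sign-fill s ps qs e₀ e₁′ dis) ⟩
    l * (cr * i)
      ≈⟨ *-identityˡ _ ⟨
    1# * (l * (cr * i))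
      -- One copy of `k` becomes the crossings of this cell with the column-0 cells still to come,
      -- the other the cost of moving `q` across `ps`.
      ≈⟨ *-congʳ (signPow² (length ps)) ⟨
    k * k * (l * (cr * i))
      ≈⟨ solve 4 (λ k l c i → k :* k :* (l :* (c :* i)) := (k :* c) :* (k :* (l :* i))) refl k l cr i ⟩
    (k * cr) * (k * (l * i))
      ≈⟨ *-cong (trans (signPow-+ (length (part 0F s)) _) (*-congʳ (signPow-≡ e₀)))
                (sign-move ps q qs q∉ps) ⟨
    signPow (length (part 0F s) ℕ.+ crossings s) * signPow (inversions (ps ++ q ∷ qs))
      ∎
    where
    e₁′ = ℕ.suc-injective e₁
    k  = signPow (length ps)
    l  = signPow (less q (ps ++ qs))
    cr = signPow (crossings s)
    i  = signPow (inversions (ps ++ qs))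

  -- Both blocks are increasing, so every inversion pairs a block-1 entry with a smaller block-0
  -- entry, and these pairs are the crossings.
  sign-parts : ∀ {n} (w : List (Fin n × Fin 2)) → Increasing w →
    signPow (inversions (part 0F w ++ part 1F w)) ≈ signPow (crossings w)
  sign-parts []             []        = refl
  sign-parts ((e , 0F) ∷ w) (e< ∷ w<) = begin
    signPow (less e (part 0F w ++ part 1F w) ℕ.+ inversions (part 0F w ++ part 1F w))
      ≡⟨ ≡.cong (λ l → signPow (l ℕ.+ inversions (part 0F w ++ part 1F w)))
           (less-none e (All.++⁺ (part-All 0F e<) (part-All 1F e<))) ⟩
    signPow (inversions (part 0F w ++ part 1F w))
      ≈⟨ sign-parts w w< ⟩
    signPow (crossings w)
      ∎
  sign-parts ((e , 1F) ∷ w) (e< ∷ w<) = begin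
    signPow (inversions (ps ++ e ∷ qs))
      ≈⟨ sign-move ps e qs (All.head (disjoint-parts ((e , 1F) ∷ w) (e< ∷ w<))) ⟩
    signPow (length ps) * (signPow (less e (ps ++ qs)) * signPow (inversions (ps ++ qs)))
      ≈⟨ *-congˡ (*-cong (signPow-≡ (less-none e (All.++⁺ (part-All 0F e<) (part-All 1F e<))))
                         (sign-parts w w<)) ⟩
    signPow (length ps) * (1# * signPow (crossings w))
      ≈⟨ *-congˡ (*-identityˡ _) ⟩
    signPow (length ps) * signPow (crossings w)
      ≈⟨ signPow-+ (length ps) _ ⟨
    signPow (length ps ℕ.+ crossings w)
      ∎
    where
    ps = part 0F w
    qs = part 1F w

-- Signed removals from a list

module Picks {c ℓ : Level} (R : CommutativeRing c ℓ) where
  open CommutativeRing R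
  open Jelly R
  open Signs R
  open import Algebra.Solver.Ring.NaturalCoefficients.Default commutativeSemiring
    using (solve; _:*_; _:+_; _:=_)
  open import Relation.Binary.Reasoning.Setoid setoid

  -- Signed sum over the ways to remove one entry from a list, with sign (-1)^position.
  Pick : ∀ {X : Set} → List X → (X → List X → Carrier) → Carrier
  Pick []      f = 0#
  Pick (x ∷ w) f = f x w + ε * Pick w (λ y w′ → f y (x ∷ w′))

  -- Supplying `w ↭ x ∷ w′` to the pointwise argument lets it track how many elements of a given
  -- label or block remain after the removal.
  Pick-cong-↭ : ∀ {X : Set} (w : List X) {f g : X → List X → Carrier} →
    (∀ x w′ → w ↭ x ∷ w′ → f x w′ ≈ g x w′) → Pick w f ≈ Pick w g
  Pick-cong-↭ []      f≈g = refl
  Pick-cong-↭ (x ∷ w) f≈g = +-cong (f≈g x w ↭-refl)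
    (*-congˡ (Pick-cong-↭ w (λ y w′ p → f≈g y (x ∷ w′) (↭-trans (prep x p) (swap x y ↭-refl)))))

  Pick-cong : ∀ {X : Set} (w : List X) {f g : X → List X → Carrier} →
    (∀ x w′ → f x w′ ≈ g x w′) → Pick w f ≈ Pick w g
  Pick-cong w f≈g = Pick-cong-↭ w (λ x w′ _ → f≈g x w′)

  Pick-zero : ∀ {X : Set} (w : List X) → Pick w (λ _ _ → 0#) ≈ 0#
  Pick-zero []      = refl
  Pick-zero (x ∷ w) = trans (+-identityˡ _) (trans (*-congˡ (Pick-zero w)) (zeroʳ ε))

  Pick-+ : ∀ {X : Set} (w : List X) (f g : X → List X → Carrier) →
    Pick w (λ x w′ → f x w′ + g x w′) ≈ Pick w f + Pick w g
  Pick-+ []      f g = sym (+-identityˡ 0#)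
  Pick-+ (x ∷ w) f g = trans (+-congˡ (*-congˡ (Pick-+ w _ _)))
    (solve 5 (λ ε a b F G → a :+ b :+ ε :* (F :+ G) := (a :+ ε :* F) :+ (b :+ ε :* G)) refl ε _ _ _ _)

  Pick-* : ∀ {X : Set} (w : List X) a (f : X → List X → Carrier) →
    Pick w (λ x w′ → a * f x w′) ≈ a * Pick w f
  Pick-* []      a f = sym (zeroʳ a)
  Pick-* (x ∷ w) a f = trans (+-congˡ (*-congˡ (Pick-* w a _)))
    (solve 4 (λ ε a x F → a :* x :+ ε :* (a :* F) := a :* (x :+ ε :* F)) refl ε _ _ _)

  Pick-≈0 : ∀ {X : Set} (w : List X) {f : X → List X → Carrier} →
    (∀ x w′ → w ↭ x ∷ w′ → f x w′ ≈ 0#) → Pick w f ≈ 0#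
  Pick-≈0 w f≈0 = trans (Pick-cong-↭ w f≈0) (Pick-zero w)

  Pick₂ : ∀ {X : Set} → List X → (X → X → List X → Carrier) → Carrier
  Pick₂ w f = Pick w (λ x w′ → Pick w′ (f x))

  -- The sign of a double removal flips when its two entries are exchanged, so only the
  -- antisymmetric part of f counts; no division by 2 is needed.
  Pick₂-exchange : ∀ {X : Set} (w : List X) (f g : X → X → List X → Carrier) →
    (∀ x y w′ → w ↭ x ∷ y ∷ w′ → f x y w′ + g y x w′ ≈ g x y w′ + f y x w′) →
    Pick₂ w f ≈ Pick₂ w g
  Pick₂-exchange []      f g _  = refl
  Pick₂-exchange (x ∷ w) f g eq = begin
    Pick w (f x) + ε * Pick w (λ y w′ → f y x w′ + ε * Pick w′ (λ z w″ → f y z (x ∷ w″)))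
      ≈⟨ expand₂ f ⟩
    Pick w (f x) + ε * Pick w (λ y → f y x) + Pick₂ w (λ y z w″ → f y z (x ∷ w″))
      ≈⟨ +-cong heads (Pick₂-exchange w _ _ (λ y z w″ p → eq y z (x ∷ w″)
           (↭-trans (prep x p) (↭-trans (swap x y ↭-refl) (prep y (swap x z ↭-refl)))))) ⟩
    Pick w (g x) + ε * Pick w (λ y → g y x) + Pick₂ w (λ y z w″ → g y z (x ∷ w″))
      ≈⟨ expand₂ g ⟨
    Pick w (g x) + ε * Pick w (λ y w′ → g y x w′ + ε * Pick w′ (λ z w″ → g y z (x ∷ w″)))
      ∎
    where
    -- The head `x` is removed first, second, or not at all. In the last case it is passed twice and
    -- the two signs cancel.
    expand₂ : ∀ h → Pick₂ (x ∷ w) h ≈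
      Pick w (h x) + ε * Pick w (λ y → h y x) + Pick₂ w (λ y z w″ → h y z (x ∷ w″))
    expand₂ h = begin
      Pick w (h x) + ε * Pick w (λ y w′ → h y x w′ + ε * Pick w′ (λ z w″ → h y z (x ∷ w″)))
        ≈⟨ +-congˡ (*-congˡ (trans (Pick-+ w _ _) (+-congˡ (Pick-* w ε _)))) ⟩
      a + ε * (b + ε * d)
        ≈⟨ solve 4 (λ ε a b d → a :+ ε :* (b :+ ε :* d) := a :+ ε :* b :+ ε :* ε :* d) refl ε a b d ⟩
      a + ε * b + ε * ε * d
        ≈⟨ +-congˡ (trans (*-congʳ ε*ε) (*-identityˡ d)) ⟩
      a + ε * b + d
        ∎
      where
      a = Pick w (h x)
      b = Pick w (λ y → h y x)
      d = Pick₂ w (λ y z w″ → h y z (x ∷ w″))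
    a b a′ b′ : Carrier
    a  = Pick w (f x)
    b  = Pick w (λ y → f y x)
    a′ = Pick w (g x)
    b′ = Pick w (λ y → g y x)
    sums : a + b′ ≈ a′ + b
    sums = begin
      a + b′                                   ≈⟨ Pick-+ w _ _ ⟨
      Pick w (λ y w′ → f x y w′ + g y x w′)    ≈⟨ Pick-cong-↭ w (λ y w′ p → eq x y w′ (prep x p)) ⟩
      Pick w (λ y w′ → g x y w′ + f y x w′)    ≈⟨ Pick-+ w _ _ ⟩
      a′ + b                                   ∎
    collapse : ∀ s t → s + (t + ε * t) ≈ s
    collapse s t = begin
      s + (t + ε * t)       ≈⟨ +-congˡ (+-congʳ (*-identityˡ t)) ⟨
      s + (1# * t + ε * t)  ≈⟨ +-congˡ (distribʳ t 1# ε) ⟨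
      s + (1# + ε) * t      ≈⟨ +-congˡ (trans (*-congʳ 1+ε) (zeroˡ t)) ⟩
      s + 0#                ≈⟨ +-identityʳ s ⟩
      s                     ∎
    -- `sums` says that the antisymmetric parts agree. Inserting a cancelling pair `t + ε * t`
    -- carries terms across the equation, which keeps every rearrangement within semiring laws.
    heads : a + ε * b ≈ a′ + ε * b′
    heads = begin
      a + ε * b                      ≈⟨ collapse _ b′ ⟨
      a + ε * b + (b′ + ε * b′)      ≈⟨ solve 4 (λ a b b′ ε → a :+ ε :* b :+ (b′ :+ ε :* b′) :=
                                          (a :+ b′) :+ (ε :* b :+ ε :* b′)) refl a b b′ ε ⟩
      (a + b′) + (ε * b + ε * b′)    ≈⟨ +-congʳ sums ⟩
      (a′ + b) + (ε * b + ε * b′)    ≈⟨ solve 4 (λ a b b′ ε → (a :+ b) :+ (ε :* b :+ ε :* b′) :=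
                                          a :+ ε :* b′ :+ (b :+ ε :* b)) refl a′ b b′ ε ⟩
      a′ + ε * b′ + (b + ε * b)      ≈⟨ collapse _ b ⟩
      a′ + ε * b′                    ∎

-- Weighted filling sums and formal labels

data Label : Set where
  inA inB inC : Label

countC : ∀ {X : Set} → List (X × Label) → ℕ
countC w = ℕ.sum (map (isC ∘ proj₂) w)
  where
  isC : Label → ℕ
  isC inA = 0
  isC inB = 0
  isC inC = 1

countC-↭ : ∀ {X : Set} {v w : List (X × Label)} → v ↭ w → countC v ≡ countC w
countC-↭ v↭w = ℕ.sum-↭ (↭.map⁺ _ v↭w)

shape : ∀ {X : Set} → List X → List X → List (Fin 2) → List (X × Fin 2)
shape []        low a = zip low a
shape (i ∷ top) low a = (i , 0F) ∷ (i , 1F) ∷ shape top low a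

module Weights {c ℓ : Level} (R : CommutativeRing c ℓ) {n : ℕ}
  (M : Fin n → Fin n → CommutativeRing.Carrier R) where
  open CommutativeRing R
  open Jelly R
  open Signs R
  open Picks R
  open import Algebra.Solver.Ring.NaturalCoefficients.Default commutativeSemiring
    using (solve; _:*_; _:+_; _:=_)
  open import Relation.Binary.Reasoning.Setoid setoid

  Weight : Set → Set c
  Weight K = Fin 2 → K → Carrier

  -- The signed sum of fillings of the shape s by the elements of w, an element
  -- labelled l being allowed in column j with weight ω j l.
  E : ∀ {K} → Weight K → List (Fin n × Fin 2) → List (Fin n × K) → Carrier
  E ω []            []      = 1#
  E ω []            (_ ∷ _) = 0#
  E ω ((i , j) ∷ s) w       = Pick w (λ { (e , l) w′ → ω j l * (M i e * E ω s w′) })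

  -- The column of a lower cell is free, so its two weights add up; this is `E` with the choice of
  -- columns already summed.
  Z-low : ∀ {K} → Weight K → List (Fin n) → List (Fin n × K) → Carrier
  Z-low ω []        []      = 1#
  Z-low ω []        (_ ∷ _) = 0#
  Z-low ω (i ∷ low) w       =
    Pick w (λ { (e , l) w′ → (ω 0F l + ω 1F l) * (M i e * Z-low ω low w′) })

  Z : ∀ {K} → Weight K → List (Fin n) → List (Fin n) → List (Fin n × K) → Carrier
  Z ω []        low w = Z-low ω low w
  Z ω (i ∷ top) low w = Pick₂ w (λ { (e , l) (e′ , l′) w″ →
    (ω 0F l * ω 1F l′) * ((M i e * M i e′) * Z ω top low w″) })

  sum-cong : ∀ {A : Set} (as : List A) {f g : A → Carrier} → (∀ a → f a ≈ g a) →
    sum (map f as) ≈ sum (map g as)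
  sum-cong []       f≈g = refl
  sum-cong (a ∷ as) f≈g = +-cong (f≈g a) (sum-cong as f≈g)

  sum-* : ∀ {A : Set} (as : List A) x (f : A → Carrier) →
    sum (map (λ a → x * f a) as) ≈ x * sum (map f as)
  sum-* []       x f = sym (zeroʳ x)
  sum-* (a ∷ as) x f = trans (+-congˡ (sum-* as x f)) (sym (distribˡ x _ _))

  sum-Pick : ∀ {A X : Set} (as : List A) (w : List X) (f : A → X → List X → Carrier) →
    sum (map (λ a → Pick w (f a)) as) ≈ Pick w (λ x w′ → sum (map (λ a → f a x w′) as))
  sum-Pick []       w f = sym (Pick-zero w)
  sum-Pick (a ∷ as) w f = trans (+-congˡ (sum-Pick as w f)) (sym (Pick-+ w _ _))

  sum-words : ∀ (as : List (List (Fin 2))) (f : List (Fin 2) → Carrier) →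
    sum (map f (concatMap (λ a → map (_∷ a) (List.allFin 2)) as)) ≈
    sum (map (f ∘ (0F ∷_)) as) + sum (map (f ∘ (1F ∷_)) as)
  sum-words []       f = sym (+-identityˡ 0#)
  sum-words (a ∷ as) f = trans (+-congˡ (+-congˡ (sum-words as f)))
    (solve 4 (λ x y s t → x :+ (y :+ (s :+ t)) := (x :+ s) :+ (y :+ t)) refl _ _ _ _)

  sum-E-low : ∀ {K} (ω : Weight K) low w →
    sum (map (λ a → E ω (zip low a) w) (allWords (length low))) ≈ Z-low ω low w
  sum-E-low ω []        []      = +-identityʳ 1#
  sum-E-low ω []        (_ ∷ _) = +-identityʳ 0#
  sum-E-low ω (i ∷ low) w       = begin
    sum (map (λ a → E ω (zip (i ∷ low) a) w) (allWords (suc (length low))))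
      ≈⟨ sum-words as _ ⟩
    S 0F + S 1F
      ≈⟨ +-cong (first 0F) (first 1F) ⟩
    Pick w (term 0F) + Pick w (term 1F)
      ≈⟨ Pick-+ w _ _ ⟨
    Pick w (λ x w′ → term 0F x w′ + term 1F x w′)
      ≈⟨ Pick-cong w (λ { _ _ → sym (distribʳ _ _ _) }) ⟩
    Z-low ω (i ∷ low) w
      ∎
    where
    as = allWords (length low)
    S : Fin 2 → Carrier
    S j = sum (map (λ a → E ω ((i , j) ∷ zip low a) w) as)
    term : Fin 2 → _ → _ → Carrier
    term j (e , l) w′ = ω j l * (M i e * Z-low ω low w′)
    first : ∀ j → S j ≈ Pick w (term j)
    first j = trans (sum-Pick as w _) (Pick-cong w (λ { (e , l) w′ →
      trans (sum-* as _ _) (*-congˡ (trans (sum-* as _ _) (*-congˡ (sum-E-low ω low w′)))) }))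

  -- The sum runs over all column words, with no condition on column sizes, so it distributes cell
  -- by cell. For `δ` the words of wrong sizes contribute 0 by themselves (`E-mismatch`).
  sum-E : ∀ {K} (ω : Weight K) top low w →
    sum (map (λ a → E ω (shape top low a) w) (allWords (length low))) ≈ Z ω top low w
  sum-E ω []        low w = sum-E-low ω low w
  sum-E ω (i ∷ top) low w =
    trans (sum-Pick as w _) (Pick-cong w (λ { (e , l) w′ → begin
      sum (map (λ a → ω 0F l * (M i e * Pick w′ (inner a))) as)
        ≈⟨ trans (sum-* as _ _) (*-congˡ (sum-* as _ _)) ⟩
      ω 0F l * (M i e * sum (map (λ a → Pick w′ (inner a)) as))
        ≈⟨ *-congˡ (*-congˡ (trans (sum-Pick as w′ _) (Pick-cong w′ (λ { (e′ , l′) w″ →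
             trans (sum-* as _ _) (*-congˡ (trans (sum-* as _ _) (*-congˡ (sum-E ω top low w″)))) })))) ⟩
      ω 0F l * (M i e * Pick w′ inner′)
        ≈⟨ trans (Pick-* w′ _ _) (*-congˡ (Pick-* w′ _ _)) ⟨
      Pick w′ (λ x w″ → ω 0F l * (M i e * inner′ x w″))
        ≈⟨ Pick-cong w′ (λ { (e′ , l′) w″ →
             solve 5 (λ a b m m′ z → a :* (m :* (b :* (m′ :* z))) := (a :* b) :* ((m :* m′) :* z))
               refl (ω 0F l) (ω 1F l′) (M i e) (M i e′) _ }) ⟩
      Pick w′ (λ { (e′ , l′) w″ → (ω 0F l * ω 1F l′) * ((M i e * M i e′) * Z ω top low w″) })
        ∎ }))
    where
    as = allWords (length low)
    inner : List (Fin 2) → _ → _ → Carrier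
    inner a (e , l) w = ω 1F l * (M i e * E ω (shape top low a) w)
    inner′ : _ → _ → Carrier
    inner′ (e , l) w = ω 1F l * (M i e * Z ω top low w)

  δ : Weight (Fin 2)
  δ 0F 0F = 1#
  δ 0F 1F = 0#
  δ 1F 0F = 0#
  δ 1F 1F = 1#

  -- Multilinear expansion: every label l is read as the formal combination
  -- ω 0 l · (block 0) + ω 1 l · (block 1).
  Exp : ∀ {K} → Weight K → List (Fin n × K) → (List (Fin n × Fin 2) → Carrier) → Carrier
  Exp ω []            f = f []
  Exp ω ((e , l) ∷ w) f = ω 0F l * Exp ω w (f ∘ ((e , 0F) ∷_)) + ω 1F l * Exp ω w (f ∘ ((e , 1F) ∷_))

  Exp-cong : ∀ {K} (ω : Weight K) w {f g} → (∀ v → f v ≈ g v) → Exp ω w f ≈ Exp ω w g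
  Exp-cong ω []            f≈g = f≈g []
  Exp-cong ω ((e , l) ∷ w) f≈g =
    +-cong (*-congˡ (Exp-cong ω w (f≈g ∘ _))) (*-congˡ (Exp-cong ω w (f≈g ∘ _)))

  Exp-+* : ∀ {K} (ω : Weight K) w a b f g →
    Exp ω w (λ v → a * f v + b * g v) ≈ a * Exp ω w f + b * Exp ω w g
  Exp-+* ω []            a b f g = refl
  Exp-+* ω ((e , l) ∷ w) a b f g =
    trans (+-cong (*-congˡ (Exp-+* ω w a b _ _)) (*-congˡ (Exp-+* ω w a b _ _)))
      (solve 8 (λ a b p q F G F′ G′ → p :* (a :* F :+ b :* G) :+ q :* (a :* F′ :+ b :* G′) :=
                 a :* (p :* F :+ q :* F′) :+ b :* (p :* G :+ q :* G′)) refl a b _ _ _ _ _ _)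

  Exp-* : ∀ {K} (ω : Weight K) w a f → Exp ω w (λ v → a * f v) ≈ a * Exp ω w f
  Exp-* ω w a f = begin
    Exp ω w (λ v → a * f v)             ≈⟨ Exp-cong ω w (λ v → pad _) ⟩
    Exp ω w (λ v → a * f v + 0# * f v)  ≈⟨ Exp-+* ω w a 0# f f ⟩
    a * Exp ω w f + 0# * Exp ω w f      ≈⟨ pad _ ⟨
    a * Exp ω w f                       ∎
    where
    pad : ∀ {x} y → x ≈ x + 0# * y
    pad y = sym (trans (+-congˡ (zeroˡ y)) (+-identityʳ _))

  -- The signs in `Pick` depend on positions and not on labels, so expanding labels commutes with
  -- removing an entry.
  Exp-Pick : ∀ {K} (ω : Weight K) w (f : Fin n × Fin 2 → List (Fin n × Fin 2) → Carrier) →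
    Exp ω w (λ v → Pick v f) ≈
    Pick w (λ { (e , l) w′ → ω 0F l * Exp ω w′ (f (e , 0F)) + ω 1F l * Exp ω w′ (f (e , 1F)) })
  Exp-Pick ω []            f = refl
  Exp-Pick {K} ω ((e , l) ∷ w) f = begin
    ω 0F l * Exp ω w (λ v → f (e , 0F) v + ε * Pick v (g 0F)) +
    ω 1F l * Exp ω w (λ v → f (e , 1F) v + ε * Pick v (g 1F))
      ≈⟨ +-cong (*-congˡ (split 0F)) (*-congˡ (split 1F)) ⟩
    ω 0F l * (Exp ω w (f (e , 0F)) + ε * Pick w (h 0F)) +
    ω 1F l * (Exp ω w (f (e , 1F)) + ε * Pick w (h 1F))
      ≈⟨ solve 7 (λ ε a b x y p q → a :* (x :+ ε :* p) :+ b :* (y :+ ε :* q) :=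
                   (a :* x :+ b :* y) :+ ε :* (a :* p :+ b :* q)) refl ε _ _ _ _ _ _ ⟩
    (ω 0F l * Exp ω w (f (e , 0F)) + ω 1F l * Exp ω w (f (e , 1F))) +
    ε * (ω 0F l * Pick w (h 0F) + ω 1F l * Pick w (h 1F))
      ≈⟨ +-congˡ (*-congˡ (trans (+-cong (sym (Pick-* w _ _)) (sym (Pick-* w _ _)))
                                 (sym (Pick-+ w _ _)))) ⟩
    (ω 0F l * Exp ω w (f (e , 0F)) + ω 1F l * Exp ω w (f (e , 1F))) +
    ε * Pick w (λ x w′ → ω 0F l * h 0F x w′ + ω 1F l * h 1F x w′)
      ≈⟨ +-congˡ (*-congˡ (Pick-cong w (λ { (e′ , l′) w′ →
           solve 8 (λ a b p q x y z t → a :* (p :* x :+ q :* y) :+ b :* (p :* z :+ q :* t) :=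
                      p :* (a :* x :+ b :* z) :+ q :* (a :* y :+ b :* t)) refl _ _ _ _ _ _ _ _ }))) ⟩
    _ ∎
    where
    g : Fin 2 → Fin n × Fin 2 → List (Fin n × Fin 2) → Carrier
    g j y v = f y ((e , j) ∷ v)
    h : Fin 2 → Fin n × K → List (Fin n × K) → Carrier
    h j (e′ , l′) w′ = ω 0F l′ * Exp ω w′ (g j (e′ , 0F)) + ω 1F l′ * Exp ω w′ (g j (e′ , 1F))
    split : ∀ j → Exp ω w (λ v → f (e , j) v + ε * Pick v (g j)) ≈
                  Exp ω w (f (e , j)) + ε * Pick w (h j)
    split j = begin
      Exp ω w (λ v → f (e , j) v + ε * Pick v (g j))
        ≈⟨ Exp-cong ω w (λ v → +-congʳ (sym (*-identityˡ _))) ⟩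
      Exp ω w (λ v → 1# * f (e , j) v + ε * Pick v (g j))
        ≈⟨ Exp-+* ω w 1# ε _ _ ⟩
      1# * Exp ω w (f (e , j)) + ε * Exp ω w (λ v → Pick v (g j))
        ≈⟨ +-cong (*-identityˡ _) (*-congˡ (Exp-Pick ω w (g j))) ⟩
      Exp ω w (f (e , j)) + ε * Pick w (h j)
        ∎

  -- A complete filling uses each element exactly once, so `E` is linear in each label separately.
  -- The case of an empty shape with elements left over is 0 on both sides.
  Exp-E : ∀ {K} (ω : Weight K) s w → Exp ω w (E δ s) ≈ E ω s w
  Exp-E ω []            []      = refl
  Exp-E ω []            (x ∷ w) = trans (+-cong (*-congˡ (zeros w)) (*-congˡ (zeros w)))
    (trans (+-cong (zeroʳ _) (zeroʳ _)) (+-identityˡ 0#))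
    where
    zeros : ∀ w → Exp ω w (λ _ → 0#) ≈ 0#
    zeros w = trans (Exp-cong ω w (λ _ → sym (zeroˡ 1#))) (trans (Exp-* ω w 0# (λ _ → 1#)) (zeroˡ _))
  Exp-E ω ((i , j) ∷ s) w       = trans (Exp-Pick ω w _) (Pick-cong w (λ { (e , l) w′ → begin
    ω 0F l * Exp ω w′ (λ v → δ j 0F * (M i e * E δ s v)) +
    ω 1F l * Exp ω w′ (λ v → δ j 1F * (M i e * E δ s v))
      ≈⟨ +-cong (*-congˡ (inner (δ j 0F) e w′)) (*-congˡ (inner (δ j 1F) e w′)) ⟩
    ω 0F l * (δ j 0F * (M i e * E ω s w′)) + ω 1F l * (δ j 1F * (M i e * E ω s w′))
      ≈⟨ solve 5 (λ a b p q z → a :* (p :* z) :+ b :* (q :* z) := (a :* p :+ b :* q) :* z)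
           refl _ _ _ _ _ ⟩
    (ω 0F l * δ j 0F + ω 1F l * δ j 1F) * (M i e * E ω s w′)
      ≈⟨ *-congʳ (select j l) ⟩
    ω j l * (M i e * E ω s w′) ∎ }))
    where
    inner : ∀ d e w′ → Exp ω w′ (λ v → d * (M i e * E δ s v)) ≈ d * (M i e * E ω s w′)
    inner d e w′ = trans (Exp-* ω w′ d _) (*-congˡ (trans (Exp-* ω w′ _ _) (*-congˡ (Exp-E ω s w′))))
    select : ∀ j l → ω 0F l * δ j 0F + ω 1F l * δ j 1F ≈ ω j l
    select 0F l = trans (+-cong (*-identityʳ _) (zeroʳ _)) (+-identityʳ _)
    select 1F l = trans (+-cong (zeroʳ _) (*-identityʳ _)) (+-identityˡ _)

  Exp-sum : ∀ {K} {A : Set} (ω : Weight K) w (as : List A) (f : A → List (Fin n × Fin 2) → Carrier) →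
    Exp ω w (λ v → sum (map (λ a → f a v) as)) ≈ sum (map (λ a → Exp ω w (f a)) as)
  Exp-sum ω w []       f = trans (Exp-cong ω w (λ _ → sym (zeroˡ 1#)))
                             (trans (Exp-* ω w 0# (λ _ → 1#)) (zeroˡ _))
  Exp-sum ω w (a ∷ as) f = begin
    Exp ω w (λ v → f a v + S v)            ≈⟨ Exp-cong ω w (λ v → sym (+-cong (*-identityˡ _) (*-identityˡ _))) ⟩
    Exp ω w (λ v → 1# * f a v + 1# * S v)  ≈⟨ Exp-+* ω w 1# 1# _ _ ⟩
    1# * Exp ω w (f a) + 1# * Exp ω w S    ≈⟨ +-cong (*-identityˡ _) (trans (*-identityˡ _) (Exp-sum ω w as f)) ⟩
    Exp ω w (f a) + sum (map (λ a → Exp ω w (f a)) as) ∎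
    where
    S : List (Fin n × Fin 2) → Carrier
    S v = sum (map (λ a → f a v) as)

  Exp-Z : ∀ {K} (ω : Weight K) top low w → Exp ω w (Z δ top low) ≈ Z ω top low w
  Exp-Z ω top low w = begin
    Exp ω w (Z δ top low)
      ≈⟨ Exp-cong ω w (λ v → sym (sum-E δ top low v)) ⟩
    Exp ω w (λ v → sum (map (λ a → E δ (shape top low a) v) as))
      ≈⟨ Exp-sum ω w as _ ⟩
    sum (map (λ a → Exp ω w (E δ (shape top low a))) as)
      ≈⟨ sum-cong as (λ a → Exp-E ω (shape top low a) w) ⟩
    sum (map (λ a → E ω (shape top low a) w) as)
      ≈⟨ sum-E ω top low w ⟩
    Z ω top low w ∎
    where as = allWords (length low)

  -- The label weights of the two sides of the theorem; on the right, S contains c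
  -- with sign -1, so inC stands for (block 1) - (block 0).
  ωˡ ωʳ : Weight Label
  ωˡ 0F inA = 1#
  ωˡ 0F inB = 1#
  ωˡ 0F inC = 0#
  ωˡ 1F inA = 0#
  ωˡ 1F inB = 0#
  ωˡ 1F inC = 1#
  ωʳ 0F inA = 1#
  ωʳ 0F inB = 0#
  ωʳ 0F inC = ε
  ωʳ 1F inA = 0#
  ωʳ 1F inB = 1#
  ωʳ 1F inC = 1#

  zero-inner : ∀ {x z} y → z ≈ 0# → x * (y * z) ≈ 0#
  zero-inner y z≈0 = trans (*-congˡ (trans (*-congˡ z≈0) (zeroʳ y))) (zeroʳ _)

  zero-factor : ∀ {x} y → x ≈ 0# → x * y ≈ 0#
  zero-factor y x≈0 = trans (*-congʳ x≈0) (zeroˡ y)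

  -- In a lower row an element of `C` has total weight `ε + 1# ≈ 0#`; if it is never placed, the
  -- filling is incomplete and counts 0.
  Zʳ-low-zero : ∀ low w → 0 ℕ.< countC w → Z-low ωʳ low w ≈ 0#
  Zʳ-low-zero []        (_ ∷ _) _  = refl
  Zʳ-low-zero (i ∷ low) w       0<  = Pick-≈0 w (λ
    { (e , inA) w′ p → zero-inner _ (Zʳ-low-zero low w′ (≡.subst (0 ℕ.<_) (countC-↭ p) 0<))
    ; (e , inB) w′ p → zero-inner _ (Zʳ-low-zero low w′ (≡.subst (0 ℕ.<_) (countC-↭ p) 0<))
    ; (e , inC) w′ p → zero-factor _ (trans (+-comm ε 1#) 1+ε) })

  -- A pigeonhole argument. A top row with at most one element of `C` leaves too many for the
  -- remaining rows. A row with two of them has a value symmetric in the pair, and symmetry is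
  -- exactly what the exchange criterion against the zero function requires.
  Zʳ-zero : ∀ top low w → length top ℕ.< countC w → Z ωʳ top low w ≈ 0#
  Zʳ-zero []        low w <C = Zʳ-low-zero low w <C
  Zʳ-zero (i ∷ top) low w <C = begin
    Pick₂ w f            ≈⟨ Pick₂-exchange w f (λ _ _ _ → 0#) cases ⟩
    Pick₂ w (λ _ _ _ → 0#)  ≈⟨ Pick-≈0 w (λ _ w′ _ → Pick-zero w′) ⟩
    0#                   ∎
    where
    f : Fin n × Label → Fin n × Label → List (Fin n × Label) → Carrier
    f (e , l) (e′ , l′) w″ = (ωʳ 0F l * ωʳ 1F l′) * ((M i e * M i e′) * Z ωʳ top low w″)
    both-zero : ∀ x y w″ → length top ℕ.< countC w″ → f x y w″ + 0# ≈ 0# + f y x w″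
    both-zero x y w″ <C″ =
      trans (+-identityʳ _) (trans (zero-inner _ z) (sym (trans (+-identityˡ _) (zero-inner _ z))))
      where z = Zʳ-zero top low w″ <C″
    cases : ∀ x y w″ → w ↭ x ∷ y ∷ w″ → f x y w″ + 0# ≈ 0# + f y x w″
    cases (e , inC) (e′ , inC) w″ p = trans (+-comm _ _) (+-congˡ (*-congˡ (*-congʳ (*-comm _ _))))
    cases x@(_ , inC) y@(_ , inA) w″ p = both-zero x y w″ (ℕ.s<s⁻¹ (≡.subst (_ ℕ.<_) (countC-↭ p) <C))
    cases x@(_ , inC) y@(_ , inB) w″ p = both-zero x y w″ (ℕ.s<s⁻¹ (≡.subst (_ ℕ.<_) (countC-↭ p) <C))
    cases x@(_ , inA) y@(_ , inC) w″ p = both-zero x y w″ (ℕ.s<s⁻¹ (≡.subst (_ ℕ.<_) (countC-↭ p) <C))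
    cases x@(_ , inB) y@(_ , inC) w″ p = both-zero x y w″ (ℕ.s<s⁻¹ (≡.subst (_ ℕ.<_) (countC-↭ p) <C))
    cases x@(_ , inA) y@(_ , inA) w″ p = both-zero x y w″ (ℕ.<-trans (ℕ.n<1+n _) (≡.subst (_ ℕ.<_) (countC-↭ p) <C))
    cases x@(_ , inA) y@(_ , inB) w″ p = both-zero x y w″ (ℕ.<-trans (ℕ.n<1+n _) (≡.subst (_ ℕ.<_) (countC-↭ p) <C))
    cases x@(_ , inB) y@(_ , inA) w″ p = both-zero x y w″ (ℕ.<-trans (ℕ.n<1+n _) (≡.subst (_ ℕ.<_) (countC-↭ p) <C))
    cases x@(_ , inB) y@(_ , inB) w″ p = both-zero x y w″ (ℕ.<-trans (ℕ.n<1+n _) (≡.subst (_ ℕ.<_) (countC-↭ p) <C))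

  Z-low-agree : ∀ low w → countC w ≡ 0 → Z-low ωˡ low w ≈ Z-low ωʳ low w
  Z-low-agree []        []      _  = refl
  Z-low-agree []        (_ ∷ _) _  = refl
  Z-low-agree (i ∷ low) w       C≡0 = Pick-cong-↭ w (λ
    { (e , inA) w′ p → *-congˡ (*-congˡ (Z-low-agree low w′ (≡.trans (≡.sym (countC-↭ p)) C≡0)))
    ; (e , inB) w′ p → *-cong (+-comm _ _)
        (*-congˡ (Z-low-agree low w′ (≡.trans (≡.sym (countC-↭ p)) C≡0)))
    ; (e , inC) w′ p → ⊥-elim (ℕ.1+n≢0 (≡.trans (≡.sym (countC-↭ p)) C≡0)) })

  -- The hypothesis is preserved exactly when a top row takes one element of `C`. A row with none is
  -- 0 on the left, where column 1 accepts only `C`, and 0 on the right by `Zʳ-zero`. A row with two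
  -- is 0 on the left and symmetric, hence cancelling, on the right.
  Z-agree : ∀ top low w → countC w ≡ length top → Z ωˡ top low w ≈ Z ωʳ top low w
  Z-agree []        low w C≡ = Z-low-agree low w C≡
  Z-agree (i ∷ top) low w C≡ = Pick₂-exchange w (f ωˡ) (f ωʳ) cases
    where
    f : Weight Label → Fin n × Label → Fin n × Label → List (Fin n × Label) → Carrier
    f ω (e , l) (e′ , l′) w″ = (ω 0F l * ω 1F l′) * ((M i e * M i e′) * Z ω top low w″)
    Goal : Fin n × Label → Fin n × Label → List (Fin n × Label) → Set ℓ
    Goal x y w″ = f ωˡ x y w″ + f ωʳ y x w″ ≈ f ωʳ x y w″ + f ωˡ y x w″
    flip-goal : ∀ x y w″ → Goal y x w″ → Goal x y w″
    flip-goal x y w″ g = trans (+-comm _ _) (trans (sym g) (+-comm _ _))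
    agree : ∀ w″ → suc (countC w″) ≡ countC w → Z ωˡ top low w″ ≈ Z ωʳ top low w″
    agree w″ eq = Z-agree top low w″ (ℕ.suc-injective (≡.trans eq C≡))
    no-C : ∀ x y w″ → f ωˡ x y w″ ≈ 0# → f ωˡ y x w″ ≈ 0# → countC w″ ≡ countC w → Goal x y w″
    no-C x y w″ fxy fyx eq =
      trans (+-cong fxy (zero-inner _ z)) (sym (+-cong (zero-inner _ z) fyx))
      where z = Zʳ-zero top low w″ (ℕ.≤-reflexive (≡.sym (≡.trans eq C≡)))
    AC : ∀ e e′ w″ → suc (countC w″) ≡ countC w → Goal (e , inA) (e′ , inC) w″
    AC e e′ w″ eq = begin
      (1# * 1#) * (m * Z ωˡ top low w″) + (ε * 0#) * _
        ≈⟨ +-cong (*-congˡ (*-congˡ (agree w″ eq))) (zero-factor _ (zeroʳ ε)) ⟩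
      (1# * 1#) * (m * Z ωʳ top low w″) + 0#
        ≈⟨ +-congˡ (zero-factor _ (zeroˡ 0#)) ⟨
      (1# * 1#) * (m * Z ωʳ top low w″) + (0# * 0#) * _
        ∎
      where m = M i e * M i e′
    -- The left side puts the `B` element in column 0, the right side in column 1 with `c` in column
    -- 0 and weight `ε`. The exchange accounts for a second sign, so the criterion reduces to
    -- `1# + ε ≈ 0#`.
    BC : ∀ e e′ w″ → suc (countC w″) ≡ countC w → Goal (e , inB) (e′ , inC) w″
    BC e e′ w″ eq = begin
      (1# * 1#) * (m * Z ωˡ top low w″) + (ε * 1#) * (m′ * Z ωʳ top low w″)
        ≈⟨ +-cong (*-cong (*-identityˡ 1#) (*-congˡ (agree w″ eq)))
                  (*-cong (*-identityʳ ε) (*-congʳ (*-comm _ _))) ⟩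
      1# * (m * Z ωʳ top low w″) + ε * (m * Z ωʳ top low w″)
        ≈⟨ distribʳ _ 1# ε ⟨
      (1# + ε) * (m * Z ωʳ top low w″)
        ≈⟨ zero-factor _ 1+ε ⟩
      0#
        ≈⟨ trans (+-cong (zero-factor _ (zeroˡ 1#)) (zero-factor _ (zeroˡ 0#))) (+-identityˡ 0#) ⟨
      (0# * 1#) * _ + (0# * 0#) * _
        ∎
      where
      m  = M i e * M i e′
      m′ = M i e′ * M i e
    cases : ∀ x y w″ → w ↭ x ∷ y ∷ w″ → Goal x y w″
    cases (e , inC) (e′ , inC) w″ p = begin
      (0# * 1#) * _ + (ε * 1#) * (_ * _)
        ≈⟨ +-cong (zero-factor _ (zeroˡ 1#)) (*-congˡ (*-congʳ (*-comm _ _))) ⟩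
      0# + (ε * 1#) * (_ * _)
        ≈⟨ +-comm _ _ ⟩
      (ε * 1#) * (_ * _) + 0#
        ≈⟨ +-congˡ (zero-factor _ (zeroˡ 1#)) ⟨
      (ε * 1#) * (_ * _) + (0# * 1#) * _
        ∎
    cases (e , inA) (e′ , inC) w″ p = AC e e′ w″ (≡.sym (countC-↭ p))
    cases (e , inB) (e′ , inC) w″ p = BC e e′ w″ (≡.sym (countC-↭ p))
    cases (e , inC) (e′ , inA) w″ p = flip-goal (e , inC) (e′ , inA) w″ (AC e′ e w″ (≡.sym (countC-↭ p)))
    cases (e , inC) (e′ , inB) w″ p = flip-goal (e , inC) (e′ , inB) w″ (BC e′ e w″ (≡.sym (countC-↭ p)))
    cases x@(_ , inA) y@(_ , inA) w″ p = no-C x y w″ (zero-factor _ (zeroʳ 1#)) (zero-factor _ (zeroʳ 1#)) (≡.sym (countC-↭ p))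
    cases x@(_ , inA) y@(_ , inB) w″ p = no-C x y w″ (zero-factor _ (zeroʳ 1#)) (zero-factor _ (zeroʳ 1#)) (≡.sym (countC-↭ p))
    cases x@(_ , inB) y@(_ , inA) w″ p = no-C x y w″ (zero-factor _ (zeroʳ 1#)) (zero-factor _ (zeroʳ 1#)) (≡.sym (countC-↭ p))
    cases x@(_ , inB) y@(_ , inB) w″ p = no-C x y w″ (zero-factor _ (zeroʳ 1#)) (zero-factor _ (zeroʳ 1#)) (≡.sym (countC-↭ p))

-- Products of two minors as filling sums

module Minors {c ℓ : Level} (R : CommutativeRing c ℓ) {n : ℕ}
  (M : Fin n → Fin n → CommutativeRing.Carrier R) where
  open CommutativeRing R
  open Jelly R
  open Signs R
  open Picks R
  open Weights R M
  open import Algebra.Solver.Ring.NaturalCoefficients.Default commutativeSemiring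
    using (solve; _:*_; _:+_; _:=_)
  open import Relation.Binary.Reasoning.Setoid setoid

  -- The local function computing a minor has no accessible name; unification
  -- recovers it once its first two arguments are generalised to variables.
  mutual
    laplace : Fin n → List (Fin n) → Fin n → List (Fin n) → List (Fin n) → ℕ → Carrier
    laplace = _

    minor-laplace : ∀ i is x cols →
      minor M (i ∷ is) (x ∷ cols) ≡ 1# * M i x * minor M is cols + laplace i is x (x ∷ []) cols 1
    minor-laplace i is x cols with [ x ] | 1
    ... | pre | k = ≡.refl

  laplace-Pick : ∀ i is x pre post k → laplace i is x pre post k ≈
    signPow k * Pick post (λ y post′ → M i y * minor M is (pre ++ post′))
  laplace-Pick i is x pre []         k = sym (zeroʳ _)
  laplace-Pick i is x pre (y ∷ post) k = begin
    signPow k * M i y * m + laplace i is x (pre ++ [ y ]) post (suc k)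
      ≈⟨ +-congˡ (laplace-Pick i is x (pre ++ [ y ]) post (suc k)) ⟩
    signPow k * M i y * m + signPow (suc k) * Pick post (λ z post′ → M i z * minor M is ((pre ++ [ y ]) ++ post′))
      ≈⟨ +-congˡ (*-cong (signPow-suc k) (Pick-cong post (λ z post′ →
           *-congˡ (reflexive (≡.cong (minor M is) (++-assoc pre [ y ] post′)))))) ⟩
    signPow k * M i y * m + ε * signPow k * Pick post (λ z post′ → M i z * minor M is (pre ++ y ∷ post′))
      ≈⟨ solve 5 (λ ε s a m p → s :* a :* m :+ ε :* s :* p := s :* (a :* m :+ ε :* p)) refl ε _ _ _ _ ⟩
    signPow k * (M i y * m + ε * Pick post (λ z post′ → M i z * minor M is (pre ++ y ∷ post′)))
      ∎
    where m = minor M is (pre ++ post)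

  minor-Pick : ∀ i is cols →
    minor M (i ∷ is) cols ≈ Pick cols (λ x cols′ → M i x * minor M is cols′)
  minor-Pick i is []         = refl
  minor-Pick i is (x ∷ cols) = begin
    minor M (i ∷ is) (x ∷ cols)
      ≡⟨ minor-laplace i is x cols ⟩
    1# * M i x * minor M is cols + laplace i is x [ x ] cols 1
      ≈⟨ +-cong (*-congʳ (*-identityˡ _)) (laplace-Pick i is x [ x ] cols 1) ⟩
    M i x * minor M is cols + ε * Pick cols (λ y cols′ → M i y * minor M is (x ∷ cols′))
      ∎

  -- Each expansion step uses up one row and one column, so one list runs out before the other. This
  -- lemma is what lets column sizes go unchecked in the filling sums.
  minor-mismatch : ∀ is cols → length is ≢ length cols → minor M is cols ≈ 0#
  minor-mismatch []       []         ≢ = ⊥-elim (≢ ≡.refl)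
  minor-mismatch []       (_ ∷ _)    ≢ = refl
  minor-mismatch (i ∷ is) cols       ≢ = trans (minor-Pick i is cols) (Pick-≈0 cols (λ x cols′ p →
    trans (*-congˡ (minor-mismatch is cols′ (λ eq → ≢ (≡.trans (≡.cong suc eq) (≡.sym (↭.↭-length p))))))
          (zeroʳ _)))

  -- Both sides vanish when the lengths differ.
  minor-sign : ∀ is cols → signPow (length is) * minor M is cols ≈ signPow (length cols) * minor M is cols
  minor-sign is cols with length is ℕ.≟ length cols
  ... | yes eq = *-congʳ (signPow-≡ eq)
  ... | no  ≢  = trans (*-congˡ z) (trans (zeroʳ _) (sym (trans (*-congˡ z) (zeroʳ _))))
    where z = minor-mismatch is cols ≢

  -- Seen in the whole list, a block-0 entry also passes the block-1 entries before it. These are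
  -- precisely the crossings that disappear with it, so the two signs agree.
  Pick-part₀ : ∀ (w : List (Fin n × Fin 2)) (f : Fin n → List (Fin n) → List (Fin n) → Carrier) →
    signPow (crossings w) * Pick (part 0F w) (λ p ps → f p ps (part 1F w)) ≈
    Pick w (λ { (e , l) w′ → δ 0F l * (signPow (crossings w′) * f e (part 0F w′) (part 1F w′)) })
  Pick-part₀ []             f = zeroʳ _
  Pick-part₀ ((e , 0F) ∷ w) f = begin
    s * (f e ps qs + ε * Pick ps (λ p ps → f p (e ∷ ps) qs))
      ≈⟨ solve 4 (λ s x ε F → s :* (x :+ ε :* F) := s :* x :+ ε :* (s :* F)) refl s _ ε _ ⟩
    s * f e ps qs + ε * (s * Pick ps (λ p ps → f p (e ∷ ps) qs))
      ≈⟨ +-cong (sym (*-identityˡ _)) (*-congˡ (Pick-part₀ w (λ p ps qs → f p (e ∷ ps) qs))) ⟩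
    1# * (s * f e ps qs) + ε * Pick w _
      ∎
    where
    s  = signPow (crossings w)
    ps = part 0F w
    qs = part 1F w
  Pick-part₀ ((e , 1F) ∷ w) f = begin
    signPow (length ps ℕ.+ crossings w) * Pick ps (λ p ps → f p ps (e ∷ qs))
      ≈⟨ trans (*-congʳ (signPow-+ (length ps) _)) (*-assoc _ _ _) ⟩
    k * (signPow (crossings w) * Pick ps (λ p ps → f p ps (e ∷ qs)))
      ≈⟨ *-congˡ (Pick-part₀ w (λ p ps qs → f p ps (e ∷ qs))) ⟩
    k * Pick w g
      ≈⟨ trans (*-congʳ (sym (trans (sym (*-assoc _ _ _)) (trans (*-congʳ ε*ε) (*-identityˡ k))))) (*-assoc _ _ _) ⟩
    ε * ((ε * k) * Pick w g)
      ≈⟨ *-congˡ (sym (Pick-* w _ g)) ⟩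
    ε * Pick w (λ x w′ → (ε * k) * g x w′)
      ≈⟨ *-congˡ (Pick-cong-↭ w λ
           { (e′ , 0F) w′ p → trans
               (solve 4 (λ a d s x → a :* (d :* (s :* x)) := d :* (a :* s :* x)) refl _ _ _ _)
               (*-congˡ (*-congʳ (trans (*-congʳ (flip w′ p)) (sym (signPow-+ (length (part 0F w′)) _)))))
           ; (e′ , 1F) w′ p → trans (*-congˡ (zeroˡ _)) (trans (zeroʳ _) (sym (zeroˡ _))) }) ⟩
    ε * Pick w g′
      ≈⟨ trans (+-congʳ (zeroˡ _)) (+-identityˡ _) ⟨
    0# * (signPow (crossings w) * f e ps qs) + ε * Pick w g′
      ∎
    where
    ps = part 0F w
    qs = part 1F w
    k  = signPow (length ps)
    g g′ : Fin n × Fin 2 → List (Fin n × Fin 2) → Carrier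
    g  (y , l) w′ = δ 0F l * (signPow (crossings w′) * f y (part 0F w′) (e ∷ part 1F w′))
    g′ (y , l) w′ = δ 0F l * (signPow (length (part 0F w′) ℕ.+ crossings w′) * f y (part 0F w′) (e ∷ part 1F w′))
    flip : ∀ {y} w′ → w ↭ (y , 0F) ∷ w′ → ε * k ≈ signPow (length (part 0F w′))
    flip w′ p = trans (sym (signPow-suc (length ps))) (signPow-≡ {suc (length ps)} {suc (suc _)} (≡.cong suc (part-↭ 0F p)))

  -- Here the extra entries passed are the block-0 entries before the removed one, while the lost
  -- crossings involve those after it. Together they are all of block 0, hence the additional
  -- `length (part 0F w)`.
  Pick-part₁ : ∀ (w : List (Fin n × Fin 2)) (f : Fin n → List (Fin n) → List (Fin n) → Carrier) →
    signPow (length (part 0F w) ℕ.+ crossings w) * Pick (part 1F w) (λ q qs → f q (part 0F w) qs) ≈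
    Pick w (λ { (e , l) w′ → δ 1F l * (signPow (crossings w′) * f e (part 0F w′) (part 1F w′)) })
  Pick-part₁ []             f = zeroʳ _
  Pick-part₁ ((e , 0F) ∷ w) f = begin
    signPow (suc (length ps ℕ.+ crossings w)) * Pick qs (λ q qs → f q (e ∷ ps) qs)
      ≈⟨ trans (*-congʳ (signPow-suc (length ps ℕ.+ crossings w))) (*-assoc _ _ _) ⟩
    ε * (signPow (length ps ℕ.+ crossings w) * Pick qs (λ q qs → f q (e ∷ ps) qs))
      ≈⟨ *-congˡ (Pick-part₁ w (λ q ps qs → f q (e ∷ ps) qs)) ⟩
    ε * Pick w _
      ≈⟨ trans (+-congʳ (zeroˡ _)) (+-identityˡ _) ⟨
    0# * (signPow (crossings w) * f e ps qs) + ε * Pick w _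
      ∎
    where
    ps = part 0F w
    qs = part 1F w
  Pick-part₁ ((e , 1F) ∷ w) f = begin
    signPow (length ps ℕ.+ (length ps ℕ.+ crossings w)) * (f e ps qs + ε * F)
      ≈⟨ *-congʳ (signPow-+ (length ps) _) ⟩
    (k * signPow (length ps ℕ.+ crossings w)) * (f e ps qs + ε * F)
      ≈⟨ solve 5 (λ k t x ε F → (k :* t) :* (x :+ ε :* F) := (k :* t) :* x :+ ε :* (k :* (t :* F)))
           refl _ _ _ _ _ ⟩
    (k * signPow (length ps ℕ.+ crossings w)) * f e ps qs +
    ε * (k * (signPow (length ps ℕ.+ crossings w) * F))
      ≈⟨ +-cong (trans (*-congʳ square) (*-assoc _ _ _))
                (*-congˡ (trans (*-congˡ (Pick-part₁ w (λ q ps qs → f q ps (e ∷ qs)))) (sym (Pick-* w k g)))) ⟩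
    1# * (signPow (crossings w) * f e ps qs) + ε * Pick w (λ x w′ → k * g x w′)
      ≈⟨ +-congˡ (*-congˡ (Pick-cong-↭ w λ
           { (e′ , 1F) w′ p → trans
               (solve 4 (λ a d s x → a :* (d :* (s :* x)) := d :* (a :* s :* x)) refl _ _ _ _)
               (*-congˡ (*-congʳ (trans (*-congʳ (signPow-≡ (part-↭ 0F p))) (sym (signPow-+ (length (part 0F w′)) _)))))
           ; (e′ , 0F) w′ p → trans (*-congˡ (zeroˡ _)) (trans (zeroʳ _) (sym (zeroˡ _))) })) ⟩
    1# * (signPow (crossings w) * f e ps qs) + ε * Pick w _
      ∎
    where
    ps = part 0F w
    qs = part 1F w
    k  = signPow (length ps)
    F  = Pick qs (λ q qs → f q ps (e ∷ qs))
    g : Fin n × Fin 2 → List (Fin n × Fin 2) → Carrier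
    g (y , l) w′ = δ 1F l * (signPow (crossings w′) * f y (part 0F w′) (e ∷ part 1F w′))
    square : k * signPow (length ps ℕ.+ crossings w) ≈ 1# * signPow (crossings w)
    square = trans (*-congˡ (signPow-+ (length ps) _)) (trans (sym (*-assoc _ _ _)) (*-congʳ (signPow² (length ps))))

  -- Cells come in reading order, so the next cell is always the first row of its own minor;
  -- expanding that minor along this row removes one element from the common list.
  E-minors : ∀ (s w : List (Fin n × Fin 2)) →
    signPow (crossings s) * signPow (crossings w) *
      (minor M (part 0F s) (part 0F w) * minor M (part 1F s) (part 1F w)) ≈ E δ s w
  E-minors []             []             = trans (*-congʳ (*-identityˡ 1#)) (trans (*-identityˡ _) (*-identityˡ 1#))
  E-minors []             ((_ , 0F) ∷ _) = trans (*-congˡ (zeroˡ _)) (zeroʳ _)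
  E-minors []             ((_ , 1F) ∷ _) = trans (*-congˡ (zeroʳ _)) (zeroʳ _)
  E-minors ((i , 0F) ∷ s) w              = begin
    cs * signPow (crossings w) * (minor M (i ∷ part 0F s) (part 0F w) * m₁)
      ≈⟨ *-congˡ (*-congʳ (minor-Pick i (part 0F s) (part 0F w))) ⟩
    cs * signPow (crossings w) * (Pick (part 0F w) (λ p ps → M i p * minor M (part 0F s) ps) * m₁)
      ≈⟨ trans (*-assoc _ _ _) (*-congˡ (*-congˡ (trans (*-comm _ _) (sym (Pick-* (part 0F w) m₁ _))))) ⟩
    cs * (signPow (crossings w) * Pick (part 0F w) (λ p ps → f p ps (part 1F w)))
      ≈⟨ *-congˡ (Pick-part₀ w f) ⟩
    cs * Pick w _
      ≈⟨ Pick-* w cs _ ⟨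
    Pick w (λ x w′ → cs * _)
      ≈⟨ Pick-cong w (λ { (e , l) w′ → trans
           (solve 6 (λ c d s m a b → c :* (d :* (s :* (b :* (m :* a)))) := d :* (m :* (c :* s :* (a :* b))))
              refl cs (δ 0F l) _ _ _ _)
           (*-congˡ (*-congˡ (E-minors s w′))) }) ⟩
    E δ ((i , 0F) ∷ s) w
      ∎
    where
    cs = signPow (crossings s)
    m₁ = minor M (part 1F s) (part 1F w)
    f : Fin n → List (Fin n) → List (Fin n) → Carrier
    f p ps qs = minor M (part 1F s) qs * (M i p * minor M (part 0F s) ps)
  E-minors ((i , 1F) ∷ s) w              = begin
    signPow (length (part 0F s) ℕ.+ crossings s) * cw * (m₀ * minor M (i ∷ part 1F s) (part 1F w))
      ≈⟨ *-cong (*-congʳ (signPow-+ (length (part 0F s)) _)) (*-congˡ (minor-Pick i (part 1F s) (part 1F w))) ⟩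
    signPow (length (part 0F s)) * cs * cw * (m₀ * P)
      ≈⟨ solve 5 (λ k c w m P → k :* c :* w :* (m :* P) := (k :* m) :* (c :* w :* P)) refl _ _ _ _ _ ⟩
    (signPow (length (part 0F s)) * m₀) * (cs * cw * P)
      -- The crossings of the shape supply the number of column-0 cells, whereas `Pick-part₁` asks
      -- for the number of block-0 elements; next to the minor either may stand for the other.
      ≈⟨ *-congʳ (minor-sign (part 0F s) (part 0F w)) ⟩
    (signPow (length (part 0F w)) * m₀) * (cs * cw * P)
      ≈⟨ solve 5 (λ k c w m P → (k :* m) :* (c :* w :* P) := c :* ((k :* w) :* (m :* P))) refl _ _ _ _ _ ⟩
    cs * ((signPow (length (part 0F w)) * cw) * (m₀ * P))
      ≈⟨ *-congˡ (*-cong (sym (signPow-+ (length (part 0F w)) _)) (sym (Pick-* (part 1F w) m₀ _))) ⟩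
    cs * (signPow (length (part 0F w) ℕ.+ crossings w) * Pick (part 1F w) (λ q qs → f q (part 0F w) qs))
      ≈⟨ *-congˡ (Pick-part₁ w f) ⟩
    cs * Pick w _
      ≈⟨ Pick-* w cs _ ⟨
    Pick w (λ x w′ → cs * _)
      ≈⟨ Pick-cong w (λ { (e , l) w′ → trans
           (solve 6 (λ c d s m a b → c :* (d :* (s :* (a :* (m :* b)))) := d :* (m :* (c :* s :* (a :* b))))
              refl cs (δ 1F l) _ _ _ _)
           (*-congˡ (*-congˡ (E-minors s w′))) }) ⟩
    E δ ((i , 1F) ∷ s) w
      ∎
    where
    cs = signPow (crossings s)
    cw = signPow (crossings w)
    m₀ = minor M (part 0F s) (part 0F w)
    P  = Pick (part 1F w) (λ q qs → M i q * minor M (part 1F s) qs)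
    f : Fin n → List (Fin n) → List (Fin n) → Carrier
    f q ps qs = minor M (part 0F s) ps * (M i q * minor M (part 1F s) qs)

  Matching : List (Fin n × Fin 2) → List (Fin n × Fin 2) → Set
  Matching s w = ∀ j → length (part j s) ≡ length (part j w)

  minors-mismatch : ∀ s w → ¬ Matching s w →
    minor M (part 0F s) (part 0F w) * minor M (part 1F s) (part 1F w) ≈ 0#
  minors-mismatch s w ¬m with length (part 0F s) ℕ.≟ length (part 0F w)
  ... | no ≢₀  = zero-factor _ (minor-mismatch (part 0F s) (part 0F w) ≢₀)
  ... | yes e₀ = trans (*-congˡ (minor-mismatch (part 1F s) (part 1F w) (λ e₁ → ¬m (λ { 0F → e₀ ; 1F → e₁ })))) (zeroʳ _)

  E-mismatch : ∀ s w → ¬ Matching s w → E δ s w ≈ 0#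
  E-mismatch s w ¬m = trans (sym (E-minors s w)) (trans (*-congˡ (minors-mismatch s w ¬m)) (zeroʳ _))

  E-sign : ∀ (s w : List (Fin n × Fin 2)) → Increasing w → Matching s w →
    signPow (inversions (fill s (part 0F w) (part 1F w))) *
      (minor M (part 0F s) (part 0F w) * minor M (part 1F s) (part 1F w)) ≈ E δ s w
  E-sign s w w< m = trans
    (*-congʳ (trans (sign-fill s _ _ (m 0F) (m 1F) (disjoint-parts w w<)) (*-congˡ (sign-parts w w<))))
    (E-minors s w)

-- Reading words of two-column tableaux

≡ᵇ-refl : ∀ m → (m ℕ.≡ᵇ m) ≡ true
≡ᵇ-refl zero    = ≡.refl
≡ᵇ-refl (suc m) = ≡ᵇ-refl m

part-zip-All : ∀ {X : Set} {P : X → Set} j {xs : List X} (a : List (Fin 2)) →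
  All P xs → All P (part j (zip xs a))
part-zip-All j a ps = part-All j (go a ps)
  where
  go : ∀ {X : Set} {P : X → Set} {xs : List X} (a : List (Fin 2)) → All P xs → All (P ∘ proj₁) (zip xs a)
  go a       []       = []
  go []      (p ∷ ps) = []
  go (_ ∷ a) (p ∷ ps) = p ∷ go a ps

part-shape : ∀ {X : Set} j (top low : List X) a → part j (shape top low a) ≡ top ++ part j (zip low a)
part-shape j  []        low a = ≡.refl
part-shape 0F (i ∷ top) low a = ≡.cong (i ∷_) (part-shape 0F top low a)
part-shape 1F (i ∷ top) low a = ≡.cong (i ∷_) (part-shape 1F top low a)

length-part-zip : ∀ {X : Set} j (low : List X) a → length a ≡ length low →
  length (part j (zip low a)) ≡ countOcc j a
length-part-zip j  []        []       _  = ≡.refl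
length-part-zip 0F (i ∷ low) (0F ∷ a) eq = ≡.cong suc (length-part-zip 0F low a (ℕ.suc-injective eq))
length-part-zip 0F (i ∷ low) (1F ∷ a) eq = length-part-zip 0F low a (ℕ.suc-injective eq)
length-part-zip 1F (i ∷ low) (0F ∷ a) eq = length-part-zip 1F low a (ℕ.suc-injective eq)
length-part-zip 1F (i ∷ low) (1F ∷ a) eq = ≡.cong suc (length-part-zip 1F low a (ℕ.suc-injective eq))

module Reading {n d : ℕ} (r : ℕ) (π : Vec (Subset n) d) where

  entry-here : ∀ i e c → entryAt r π i ((i , e) ∷ c) ≡ [ e ]
  entry-here i e c rewrite ≡ᵇ-refl (toℕ i) = ≡.refl

  entry-there : ∀ {i k} e c → k ≢ i → entryAt r π i ((k , e) ∷ c) ≡ entryAt r π i c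
  entry-there {i} {k} e c k≢i with toℕ k ℕ.≡ᵇ toℕ i in eq
  ... | false = ≡.refl
  ... | true  = ⊥-elim (k≢i (toℕ-injective (ℕ.≡ᵇ⇒≡ (toℕ k) (toℕ i) (≡.subst T (≡.sym eq) tt))))

  entry-absent : ∀ {i ks} es → All (i ≢_) ks → entryAt r π i (zip ks es) ≡ []
  entry-absent                es       []         = ≡.refl
  entry-absent                []       (_   ∷ _)  = ≡.refl
  entry-absent {ks = k ∷ ks} (e ∷ es) (i≢k ∷ i∉) =
    ≡.trans (entry-there e (zip ks es) (i≢k ∘ ≡.sym)) (entry-absent es i∉)

  -- The final `++ []` is left by `concatMap` over the two columns; with it the reading word is a
  -- `scan` by computation.
  scan : List (Fin n × Fin n) → List (Fin n × Fin n) → List (Fin n) → List (Fin n)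
  scan c₀ c₁ = concatMap (λ i → entryAt r π i c₀ ++ (entryAt r π i c₁ ++ []))

  scan-skip₀ : ∀ {i rows} e c₀ c₁ → All (i ≢_) rows → scan ((i , e) ∷ c₀) c₁ rows ≡ scan c₀ c₁ rows
  scan-skip₀ e c₀ c₁ []          = ≡.refl
  scan-skip₀ e c₀ c₁ (i≢k ∷ i∉) = ≡.cong₂ _++_
    (≡.cong (_++ (entryAt r π _ c₁ ++ [])) (entry-there e c₀ i≢k)) (scan-skip₀ e c₀ c₁ i∉)

  scan-skip₁ : ∀ {i rows} e c₀ c₁ → All (i ≢_) rows → scan c₀ ((i , e) ∷ c₁) rows ≡ scan c₀ c₁ rows
  scan-skip₁ e c₀ c₁ []          = ≡.refl
  scan-skip₁ e c₀ c₁ (i≢k ∷ i∉) = ≡.cong₂ _++_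
    (≡.cong (λ x → entryAt r π _ c₀ ++ (x ++ [])) (entry-there e c₁ i≢k)) (scan-skip₁ e c₀ c₁ i∉)

  scan-low : ∀ low a ps qs → AllPairs _≢_ low →
    length (part 0F (zip low a)) ≡ length ps → length (part 1F (zip low a)) ≡ length qs →
    length a ≡ length low →
    scan (zip (part 0F (zip low a)) ps) (zip (part 1F (zip low a)) qs) low ≡ fill (zip low a) ps qs
  scan-low []        []       ps       qs       _          _  _  _ = ≡.refl
  scan-low (i ∷ low) (0F ∷ a) (p ∷ ps) qs       (i∉ ∷ low!) e₀ e₁ eq = ≡.cong₂ _++_
    (≡.cong₂ (λ x y → x ++ (y ++ [])) (entry-here i p c₀) (entry-absent qs (part-zip-All 1F a i∉)))
    (≡.trans (scan-skip₀ p c₀ c₁ i∉)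
      (scan-low low a ps qs low! (ℕ.suc-injective e₀) e₁ (ℕ.suc-injective eq)))
    where
    c₀ = zip (part 0F (zip low a)) ps
    c₁ = zip (part 1F (zip low a)) qs
  scan-low (i ∷ low) (1F ∷ a) ps       (q ∷ qs) (i∉ ∷ low!) e₀ e₁ eq = ≡.cong₂ _++_
    (≡.cong₂ (λ x y → x ++ (y ++ [])) (entry-absent ps (part-zip-All 0F a i∉)) (entry-here i q c₁))
    (≡.trans (scan-skip₁ q c₀ c₁ i∉)
      (scan-low low a ps qs low! e₀ (ℕ.suc-injective e₁) (ℕ.suc-injective eq)))
    where
    c₀ = zip (part 0F (zip low a)) ps
    c₁ = zip (part 1F (zip low a)) qs

  scan-fill : ∀ top low a ps qs → AllPairs _≢_ (top ++ low) →
    length (top ++ part 0F (zip low a)) ≡ length ps → length (top ++ part 1F (zip low a)) ≡ length qs →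
    length a ≡ length low →
    scan (zip (top ++ part 0F (zip low a)) ps) (zip (top ++ part 1F (zip low a)) qs) (top ++ low) ≡
    fill (shape top low a) ps qs
  scan-fill []        low a ps       qs       low!      e₀ e₁ eq = scan-low low a ps qs low! e₀ e₁ eq
  scan-fill (i ∷ top) low a (p ∷ ps) (q ∷ qs) (i∉ ∷ rows!) e₀ e₁ eq = ≡.cong₂ _++_
    (≡.cong₂ (λ x y → x ++ (y ++ [])) (entry-here i p c₀) (entry-here i q c₁))
    (≡.trans (scan-skip₀ p c₀ ((i , q) ∷ c₁) i∉) (≡.trans (scan-skip₁ q c₀ c₁ i∉)
      (scan-fill top low a ps qs rows! (ℕ.suc-injective e₀) (ℕ.suc-injective e₁) eq)))
    where
    c₀ = zip (top ++ part 0F (zip low a)) ps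
    c₁ = zip (top ++ part 1F (zip low a)) qs

-- Row lists and two-block partitions

allFin-increasing : ∀ n → AllPairs (λ i j → toℕ i ℕ.< toℕ j) (List.allFin n)
allFin-increasing n = AllPairs.tabulate⁺-< id

filter-split : ∀ {n} {r N} → r ℕ.≤ N → (is : List (Fin n)) → AllPairs (λ i j → toℕ i ℕ.< toℕ j) is →
  filter (λ i → toℕ i ℕ.<? N) is ≡
  filter (λ i → toℕ i ℕ.<? r) is ++ filter (λ i → r ℕ.≤? toℕ i) (filter (λ i → toℕ i ℕ.<? N) is)
filter-split r≤N []       []        = ≡.refl
filter-split {r = r} {N} r≤N (i ∷ is) (i< ∷ is<) with r ℕ.≤? toℕ i
-- The list increases, so from the first row that is at least `r` on, nothing belongs to the top
-- part.
... | yes r≤i = ≡.sym (≡.cong₂ _++_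
  (filter-none (λ i → toℕ i ℕ.<? r) (ℕ.≤⇒≯ r≤i ∷ All.map (λ i<k → ℕ.≤⇒≯ (ℕ.≤-trans r≤i (ℕ.<⇒≤ i<k))) i<))
  (filter-all (λ i → r ℕ.≤? toℕ i) (All.filter⁺ (λ i → toℕ i ℕ.<? N)
    (r≤i ∷ All.map (λ i<k → ℕ.≤-trans r≤i (ℕ.<⇒≤ i<k)) i<))))
... | no r≰i = ≡.trans (filter-accept below-N i<N) (≡.sym (≡.trans
  (≡.cong₂ (λ xs ys → xs ++ filter (λ i → r ℕ.≤? toℕ i) ys)
    (filter-accept (λ i → toℕ i ℕ.<? r) (ℕ.≰⇒> r≰i)) (filter-accept below-N i<N))
  (≡.cong (i ∷_) (≡.trans
    (≡.cong (filter (λ i → toℕ i ℕ.<? r) is ++_) (filter-reject (λ i → r ℕ.≤? toℕ i) r≰i))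
    (≡.sym (filter-split r≤N is is<))))))
  where
  i<N = ℕ.<-≤-trans (ℕ.≰⇒> r≰i) r≤N
  below-N = λ (i : Fin _) → toℕ i ℕ.<? N

rowsBelow-split : ∀ {n r N} → r ℕ.≤ N → rowsBelow {n} N ≡ rowsBelow r ++ rowsBetween r N
rowsBelow-split r≤N = filter-split r≤N _ (allFin-increasing _)

rowsBelow-unique : ∀ {n} N → AllPairs _≢_ (rowsBelow {n} N)
rowsBelow-unique N = AllPairs.map (λ i<j i≡j → ℕ.<-irrefl (≡.cong toℕ i≡j) i<j)
  (AllPairs.filter⁺ _ (allFin-increasing _))

length-rowsBelow : ∀ {n} r → r ℕ.≤ n → length (rowsBelow {n} r) ≡ r
length-rowsBelow {n} r r≤n = go n r 0 id (λ _ → ≡.refl) r≤n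
  where
  -- A tail of `allFin` is a tabulation of shifted indices; `k` records the shift.
  go : ∀ m r k (ρ : Fin m → Fin n) → (∀ i → toℕ (ρ i) ≡ k ℕ.+ toℕ i) → r ℕ.≤ m →
    length (filter (λ i → toℕ i ℕ.<? k ℕ.+ r) (List.tabulate ρ)) ≡ r
  go m zero    k ρ ρ≡ _ = ≡.cong length (filter-none (λ i → toℕ i ℕ.<? k ℕ.+ 0) (All.tabulate⁺ (λ i →
    ℕ.≤⇒≯ (ℕ.≤-trans (ℕ.+-monoʳ-≤ k z≤n) (ℕ.≤-reflexive (≡.sym (ρ≡ i)))))))
  go (suc m) (suc r) k ρ ρ≡ (s≤s r≤m) = ≡.trans
    (≡.cong length (filter-accept (λ i → toℕ i ℕ.<? k ℕ.+ suc r)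
      (≡.subst (ℕ._< k ℕ.+ suc r) (≡.sym (ρ≡ 0F)) (ℕ.+-monoʳ-< k (s≤s z≤n)))))
    (≡.cong suc (≡.trans
      (≡.cong (λ N → length (filter (λ i → toℕ i ℕ.<? N) (List.tabulate (ρ ∘ Fin.suc)))) (ℕ.+-suc k r))
      (go m r (suc k) (ρ ∘ Fin.suc) (λ i → ≡.trans (ρ≡ (Fin.suc i)) (ℕ.+-suc k (toℕ i))) r≤m)))

allWords-length : ∀ {d} m → All (λ a → length a ≡ m) (allWords {d} m)
allWords-length zero    = ≡.refl ∷ []
allWords-length (suc m) = All.concat⁺ (All.map⁺ (All.map
  (λ eq → All.map⁺ (All.tabulate⁺ (λ _ → ≡.cong suc eq))) (allWords-length m)))

isIn : Fin 2 → Fin 2 → Bool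
isIn 0F 0F = inside
isIn 0F 1F = outside
isIn 1F 0F = outside
isIn 1F 1F = inside

block : ∀ {m} → Fin 2 → Vec (Fin 2) m → Subset m
block j = Vec.map (isIn j)

labelled : ∀ {m n} {K : Set} → (Fin m → Fin n) → Vec K m → List (Fin n × K)
labelled ρ []      = []
labelled ρ (l ∷ u) = (ρ 0F , l) ∷ labelled (ρ ∘ Fin.suc) u

labelled-All : ∀ {m n} {K : Set} {P : Fin n → Set} (ρ : Fin m → Fin n) (u : Vec K m) →
  (∀ i → P (ρ i)) → All (P ∘ proj₁) (labelled ρ u)
labelled-All ρ []      p = []
labelled-All ρ (l ∷ u) p = p 0F ∷ labelled-All (ρ ∘ Fin.suc) u (p ∘ Fin.suc)

labelled-increasing : ∀ {m n} {K : Set} (ρ : Fin m → Fin n) (u : Vec K m) →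
  (∀ {i j} → toℕ i ℕ.< toℕ j → toℕ (ρ i) ℕ.< toℕ (ρ j)) → Increasing (labelled ρ u)
labelled-increasing ρ []      mono = []
labelled-increasing ρ (l ∷ u) mono =
  labelled-All {P = λ e → toℕ (ρ 0F) ℕ.< toℕ e} (ρ ∘ Fin.suc) u (λ _ → mono (s≤s z≤n)) ∷
  labelled-increasing (ρ ∘ Fin.suc) u (mono ∘ s≤s)

part-labelled : ∀ {m n} j (ρ : Fin m → Fin n) (u : Vec (Fin 2) m) →
  part j (labelled ρ u) ≡ map ρ (elems (block j u))
part-labelled j  ρ []       = ≡.refl
part-labelled 0F ρ (0F ∷ u) = ≡.cong (ρ 0F ∷_) (≡.trans (part-labelled 0F (ρ ∘ Fin.suc) u) (map-∘ _))
part-labelled 0F ρ (1F ∷ u) = ≡.trans (part-labelled 0F (ρ ∘ Fin.suc) u) (map-∘ _)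
part-labelled 1F ρ (0F ∷ u) = ≡.trans (part-labelled 1F (ρ ∘ Fin.suc) u) (map-∘ _)
part-labelled 1F ρ (1F ∷ u) = ≡.cong (ρ 0F ∷_) (≡.trans (part-labelled 1F (ρ ∘ Fin.suc) u) (map-∘ _))

elems-block : ∀ {n} j (u : Vec (Fin 2) n) → elems (block j u) ≡ part j (labelled id u)
elems-block j u = ≡.sym (≡.trans (part-labelled j id u) (map-id _))

length-elems : ∀ {n} (p : Subset n) → length (elems p) ≡ ∣ p ∣
length-elems []            = ≡.refl
length-elems (inside  ∷ p) = ≡.cong suc (≡.trans (length-map Fin.suc (elems p)) (length-elems p))
length-elems (outside ∷ p) = ≡.trans (length-map Fin.suc (elems p)) (length-elems p)

size-part : ∀ {n} j (u : Vec (Fin 2) n) → length (part j (labelled id u)) ≡ ∣ block j u ∣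
size-part j u = ≡.trans (≡.cong length (≡.sym (elems-block j u))) (length-elems (block j u))

block-sizes : ∀ {n} (u : Vec (Fin 2) n) → ∣ block 0F u ∣ ℕ.+ ∣ block 1F u ∣ ≡ n
block-sizes []       = ≡.refl
block-sizes (0F ∷ u) = ≡.cong suc (block-sizes u)
block-sizes (1F ∷ u) = ≡.trans (ℕ.+-suc _ _) (≡.cong suc (block-sizes u))

-- The jellyfish invariant as a filling sum

module Tableaux {c ℓ : Level} (R : CommutativeRing c ℓ) {n : ℕ}
  (M : Fin n → Fin n → CommutativeRing.Carrier R) where
  open CommutativeRing R
  open Jelly R
  open Signs R
  open Weights R M
  open Minors R M
  open import Relation.Binary.Reasoning.Setoid setoid

  sum-filter : ∀ {A : Set} (b : A → Bool) (f g : A → Carrier) (as : List A) →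
    All (λ a → (T (b a) → f a ≈ g a) × (¬ T (b a) → g a ≈ 0#)) as →
    sum (map f (filter (λ a → T? (b a)) as)) ≈ sum (map g as)
  sum-filter b f g []       []              = refl
  sum-filter b f g (a ∷ as) ((y , z) ∷ eqs) with b a
  ... | true  = +-cong (y tt) (sum-filter b f g as eqs)
  ... | false = trans (sum-filter b f g as eqs) (sym (trans (+-congʳ (z id)) (+-identityˡ _)))

  sum-≈0 : ∀ {A : Set} {f : A → Carrier} {as : List A} → All (λ a → f a ≈ 0#) as → sum (map f as) ≈ 0#
  sum-≈0 []       = refl
  sum-≈0 (z ∷ zs) = trans (+-cong z (sum-≈0 zs)) (+-identityˡ 0#)

  matching? : ∀ s w → Dec (Matching s w)
  matching? s w with length (part 0F s) ℕ.≟ length (part 0F w) | length (part 1F s) ℕ.≟ length (part 1F w)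
  ... | yes e₀ | yes e₁ = yes λ { 0F → e₀ ; 1F → e₁ }
  ... | no ≢₀  | _      = no λ m → ≢₀ (m 0F)
  ... | _      | no ≢₁  = no λ m → ≢₁ (m 1F)

  module _ (r : ℕ) (r≤n : r ℕ.≤ n) (u : Vec (Fin 2) n) where

    π : Vec (Subset n) 2
    π = block 0F u ∷ block 1F u ∷ []

    top low : List (Fin n)
    top = topRows r π
    low = lowerRows r π

    w : List (Fin n × Fin 2)
    w = labelled id u

    summand : List (Fin 2) → Carrier
    summand a = signPow (inversions (readingWord r π a)) *
      prod (map (λ j → minor M (rowSet r π a j) (elems (Vec.lookup π j))) (List.allFin 2))

    size-shape : ∀ j a → length a ≡ length low → length (part j (shape top low a)) ≡ r ℕ.+ countOcc j a
    size-shape j a eq = ≡.trans (≡.cong length (part-shape j top low a)) (≡.trans (length-++ top)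
      (≡.cong₂ ℕ._+_ (length-rowsBelow r r≤n) (length-part-zip j low a eq)))

    small-mismatch : ∀ j a → length a ≡ length low → ∣ block j u ∣ ℕ.< r → ¬ Matching (shape top low a) w
    small-mismatch j a eq small m = ℕ.<⇒≱ small (ℕ.≤-trans (ℕ.m≤m+n r (countOcc j a))
      (ℕ.≤-reflexive (≡.trans (≡.sym (size-shape j a eq)) (≡.trans (m j) (size-part j u)))))

    matching⇒valid : ∀ a → length a ≡ length low → Matching (shape top low a) w → T (validAssign r π a)
    matching⇒valid a eq m = from T-∧ (count 0F , from T-∧ (count 1F , tt))
      where
      open Equivalence
      exact : ∀ j → countOcc j a ≡ ∣ block j u ∣ ℕ.∸ r
      exact j = ≡.trans (≡.sym (ℕ.m+n∸m≡n r _))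
        (≡.cong (ℕ._∸ r) (≡.trans (≡.sym (size-shape j a eq)) (≡.trans (m j) (size-part j u))))
      count : ∀ j → T (countOcc j a ℕ.≡ᵇ (∣ block j u ∣ ℕ.∸ r))
      count j = ℕ.≡⇒≡ᵇ (countOcc j a) _ (exact j)

    readingWord-fill : ∀ a → length a ≡ length low → r ℕ.≤ n ℕ.∸ (1 ℕ.* r) → Matching (shape top low a) w →
      readingWord r π a ≡ fill (shape top low a) (part 0F w) (part 1F w)
    readingWord-fill a eq r≤N m =
      ≡.trans (≡.cong₂ (λ ps qs → scan (zip (rowSet r π a 0F) ps) (zip (rowSet r π a 1F) qs) (rowsBelow N))
                (elems-block 0F u) (elems-block 1F u))
      (≡.trans (≡.cong (scan (zip (rowSet r π a 0F) (part 0F w)) (zip (rowSet r π a 1F) (part 1F w)))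
                (rowsBelow-split r≤N))
        (scan-fill top low a (part 0F w) (part 1F w)
          (≡.subst (AllPairs _≢_) (rowsBelow-split r≤N) (rowsBelow-unique N))
          (size 0F) (size 1F) eq))
      where
      open Reading r π
      N = n ℕ.∸ (1 ℕ.* r)
      size : ∀ j → length (top ++ part j (zip low a)) ≡ length (part j w)
      size j = ≡.trans (≡.cong length (≡.sym (part-shape j top low a))) (m j)

    summand-minors : ∀ a → summand a ≈ signPow (inversions (readingWord r π a)) *
      (minor M (part 0F (shape top low a)) (part 0F w) * minor M (part 1F (shape top low a)) (part 1F w))
    summand-minors a = *-congˡ (*-cong (same 0F) (trans (*-identityʳ _) (same 1F)))
      where
      same : ∀ j → minor M (top ++ part j (zip low a)) (elems (block j u)) ≈
                   minor M (part j (shape top low a)) (part j w)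
      same j = reflexive (≡.cong₂ (minor M) (≡.sym (part-shape j top low a)) (elems-block j u))

    -- The reading word is a filling only if the column sizes match the blocks. Otherwise its sign
    -- is immaterial, because the product of minors vanishes.
    summand-E : ∀ a → length a ≡ length low → r ℕ.≤ n ℕ.∸ (1 ℕ.* r) →
      summand a ≈ E δ (shape top low a) w
    summand-E a eq r≤N with matching? (shape top low a) w
    ... | no ¬m = trans (summand-minors a) (trans (*-congˡ (minors-mismatch (shape top low a) w ¬m))
                    (trans (zeroʳ _) (sym (E-mismatch (shape top low a) w ¬m))))
    ... | yes m = begin
      summand a
        ≈⟨ summand-minors a ⟩
      signPow (inversions (readingWord r π a)) * _
        ≈⟨ *-congʳ (signPow-≡ (≡.cong inversions (readingWord-fill a eq r≤N m))) ⟩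
      signPow (inversions (fill (shape top low a) (part 0F w) (part 1F w))) * _
        ≈⟨ E-sign (shape top low a) w (labelled-increasing id u id) m ⟩
      E δ (shape top low a) w
        ∎

    small-zero : ∀ j → ¬ r ℕ.≤ ∣ block j u ∣ → Z δ top low w ≈ 0#
    small-zero j r≰ = trans (sym (sum-E δ top low w)) (sum-≈0 (All.map
      (λ {a} eq → E-mismatch (shape top low a) w (small-mismatch j a eq (ℕ.≰⇒> r≰)))
      (allWords-length (length low))))

    -- A column meets all `r` top rows, so a smaller block fits no shape and the filling sum agrees
    -- with the conventional value 0. The formula therefore covers every two-block `u`, and every
    -- `S` can be treated alike.
    jellyfish-Z : jellyfish M r π ≈ Z δ top low w
    jellyfish-Z with r ℕ.≤ᵇ ∣ block 0F u ∣ in eq₀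
    ... | false = sym (small-zero 0F (λ r≤ → ≡.subst T eq₀ (ℕ.≤⇒≤ᵇ r≤)))
    ... | true with r ℕ.≤ᵇ ∣ block 1F u ∣ in eq₁
    ...   | false = sym (small-zero 1F (λ r≤ → ≡.subst T eq₁ (ℕ.≤⇒≤ᵇ r≤)))
    ...   | true  = trans
      (sum-filter (validAssign r π) summand (λ a → E δ (shape top low a) w) _
        (All.map (λ {a} eq → (λ _ → summand-E a eq r≤N) ,
                             (λ ¬valid → E-mismatch (shape top low a) w (¬valid ∘ matching⇒valid a eq)))
          (allWords-length (length low))))
      (sum-E δ top low w)
      where
      large : ∀ j → (r ℕ.≤ᵇ ∣ block j u ∣) ≡ true → r ℕ.≤ ∣ block j u ∣
      large j eq = ℕ.≤ᵇ⇒≤ r _ (≡.subst T (≡.sym eq) tt)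
      -- Splitting the rows at `r` requires at least `r` rows; two blocks of size at least `r` in a
      -- set of size `n` guarantee this.
      r≤N : r ℕ.≤ n ℕ.∸ (1 ℕ.* r)
      r≤N = ≡.subst (λ k → r ℕ.≤ n ℕ.∸ k) (≡.sym (ℕ.*-identityˡ r)) (ℕ.m+n≤o⇒m≤o∸n r
        (ℕ.≤-trans (ℕ.+-mono-≤ (large 0F eq₀) (large 1F eq₁)) (ℕ.≤-reflexive (block-sizes u))))

-- Labelling by the three sets and the alternating sum

_≟ᴸ_ : Label → Label → Bool
inA ≟ᴸ inA = true
inB ≟ᴸ inB = true
inC ≟ᴸ inC = true
_   ≟ᴸ _   = false

region : ∀ {m} → Label → Vec Label m → Subset m
region k = Vec.map (k ≟ᴸ_)

countC-labelled : ∀ {m n} (ρ : Fin m → Fin n) v → countC (labelled ρ v) ≡ ∣ region inC v ∣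
countC-labelled ρ []        = ≡.refl
countC-labelled ρ (inA ∷ v) = countC-labelled (ρ ∘ Fin.suc) v
countC-labelled ρ (inB ∷ v) = countC-labelled (ρ ∘ Fin.suc) v
countC-labelled ρ (inC ∷ v) = ≡.cong suc (countC-labelled (ρ ∘ Fin.suc) v)

-- At each position the disjointness and covering equations exclude every Boolean triple except the
-- three with exactly one member.
labelling : ∀ {m} (A B C : Subset m) → A ∩ B ≡ ⊥ → A ∩ C ≡ ⊥ → B ∩ C ≡ ⊥ → A ∪ B ∪ C ≡ ⊤ →
  Σ (Vec Label m) λ v → A ≡ region inA v × B ≡ region inB v × C ≡ region inC v
labelling []      []      []      _  _  _  _   = [] , ≡.refl , ≡.refl , ≡.refl
labelling (a ∷ A) (b ∷ B) (c ∷ C) AB AC BC ABC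
  with labelling A B C (∷-injectiveʳ AB) (∷-injectiveʳ AC) (∷-injectiveʳ BC) (∷-injectiveʳ ABC)
labelling (true  ∷ _) (false ∷ _) (false ∷ _) _ _ _ _ | v , ≡.refl , ≡.refl , ≡.refl = inA ∷ v , ≡.refl , ≡.refl , ≡.refl
labelling (false ∷ _) (true  ∷ _) (false ∷ _) _ _ _ _ | v , ≡.refl , ≡.refl , ≡.refl = inB ∷ v , ≡.refl , ≡.refl , ≡.refl
labelling (false ∷ _) (false ∷ _) (true  ∷ _) _ _ _ _ | v , ≡.refl , ≡.refl , ≡.refl = inC ∷ v , ≡.refl , ≡.refl , ≡.refl

side : Label → Fin 2
side inA = 0F
side inB = 0F
side inC = 1F

block₀-side : ∀ {m} (v : Vec Label m) → region inA v ∪ region inB v ≡ block 0F (Vec.map side v)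
block₀-side []        = ≡.refl
block₀-side (inA ∷ v) = ≡.cong (inside ∷_) (block₀-side v)
block₀-side (inB ∷ v) = ≡.cong (inside ∷_) (block₀-side v)
block₀-side (inC ∷ v) = ≡.cong (outside ∷_) (block₀-side v)

block₁-side : ∀ {m} (v : Vec Label m) → region inC v ≡ block 1F (Vec.map side v)
block₁-side []        = ≡.refl
block₁-side (inA ∷ v) = ≡.cong (outside ∷_) (block₁-side v)
block₁-side (inB ∷ v) = ≡.cong (outside ∷_) (block₁-side v)
block₁-side (inC ∷ v) = ≡.cong (inside ∷_) (block₁-side v)

module Exchange {c ℓ : Level} (R : CommutativeRing c ℓ) {n : ℕ}
  (M : Fin n → Fin n → CommutativeRing.Carrier R) where
  open CommutativeRing R
  open Jelly R
  open Signs R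
  open Weights R M
  open Tableaux R M using (jellyfish-Z)
  open import Algebra.Solver.Ring.NaturalCoefficients.Default commutativeSemiring
    using (solve; _:*_; _:+_; _:=_)
  open import Relation.Binary.Reasoning.Setoid setoid

  1*-+0* : ∀ x y → 1# * x + 0# * y ≈ x
  1*-+0* x y = trans (+-cong (*-identityˡ x) (zeroˡ y)) (+-identityʳ x)

  0*-+1* : ∀ x y → 0# * x + 1# * y ≈ y
  0*-+1* x y = trans (+-cong (zeroˡ x) (*-identityˡ y)) (+-identityˡ y)

  Exp-ωˡ : ∀ {m} (ρ : Fin m → Fin n) (v : Vec Label m) g →
    Exp ωˡ (labelled ρ v) g ≈ g (labelled ρ (Vec.map side v))
  Exp-ωˡ ρ []        g = refl
  Exp-ωˡ ρ (inA ∷ v) g = trans (1*-+0* _ _) (Exp-ωˡ (ρ ∘ Fin.suc) v _)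
  Exp-ωˡ ρ (inB ∷ v) g = trans (1*-+0* _ _) (Exp-ωˡ (ρ ∘ Fin.suc) v _)
  Exp-ωˡ ρ (inC ∷ v) g = trans (0*-+1* _ _) (Exp-ωˡ (ρ ∘ Fin.suc) v _)

  sum-subsets-cons : ∀ {m} (Ss : List (Subset m)) (f : Subset (suc m) → Carrier) →
    sum (map f (concatMap (λ S → (outside ∷ S) ∷ (inside ∷ S) ∷ []) Ss)) ≈
    sum (map (f ∘ (inside ∷_)) Ss) + sum (map (f ∘ (outside ∷_)) Ss)
  sum-subsets-cons []       f = sym (+-identityˡ 0#)
  sum-subsets-cons (S ∷ Ss) f = trans (+-congˡ (+-congˡ (sum-subsets-cons Ss f)))
    (solve 4 (λ o i I O → o :+ (i :+ (I :+ O)) := (i :+ I) :+ (o :+ O)) refl _ _ _ _)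

  -- Choosing `S` means choosing, for each `c`, block 0 with factor `ε` or block 1 with factor `1#`.
  -- The functions `f` and `g` are arbitrary so that the induction can absorb the first position
  -- into them.
  Exp-ωʳ : ∀ {m} (ρ : Fin m → Fin n) (v : Vec Label m)
    (f : Subset m → Subset m → Carrier) (g : List (Fin n × Fin 2) → Carrier) →
    (∀ u → f (block 0F u) (block 1F u) ≈ g (labelled ρ u)) →
    sum (map (λ S → signPow ∣ S ∣ * f (region inA v ∪ S) (region inB v ∪ (region inC v ─ S)))
             (subsetsOf (region inC v))) ≈
    Exp ωʳ (labelled ρ v) g
  Exp-ωʳ ρ []        f g f≈g = trans (+-identityʳ _) (trans (*-identityˡ _) (f≈g []))
  Exp-ωʳ ρ (inA ∷ v) f g f≈g = begin
    sum (map _ (map (outside ∷_) Ss))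
      ≡⟨ ≡.cong sum (map-∘ Ss) ⟨
    sum (map _ Ss)
      ≈⟨ Exp-ωʳ (ρ ∘ Fin.suc) v (λ P Q → f (inside ∷ P) (outside ∷ Q)) (g ∘ ((ρ 0F , 0F) ∷_)) (f≈g ∘ (0F ∷_)) ⟩
    Exp ωʳ (labelled (ρ ∘ Fin.suc) v) (g ∘ ((ρ 0F , 0F) ∷_))
      ≈⟨ 1*-+0* _ _ ⟨
    1# * Exp ωʳ (labelled (ρ ∘ Fin.suc) v) (g ∘ ((ρ 0F , 0F) ∷_)) + 0# * _
      ∎
    where Ss = subsetsOf (region inC v)
  Exp-ωʳ ρ (inB ∷ v) f g f≈g = begin
    sum (map _ (map (outside ∷_) Ss))
      ≡⟨ ≡.cong sum (map-∘ Ss) ⟨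
    sum (map _ Ss)
      ≈⟨ Exp-ωʳ (ρ ∘ Fin.suc) v (λ P Q → f (outside ∷ P) (inside ∷ Q)) (g ∘ ((ρ 0F , 1F) ∷_)) (f≈g ∘ (1F ∷_)) ⟩
    Exp ωʳ (labelled (ρ ∘ Fin.suc) v) (g ∘ ((ρ 0F , 1F) ∷_))
      ≈⟨ 0*-+1* _ _ ⟨
    0# * _ + 1# * Exp ωʳ (labelled (ρ ∘ Fin.suc) v) (g ∘ ((ρ 0F , 1F) ∷_))
      ∎
    where Ss = subsetsOf (region inC v)
  Exp-ωʳ ρ (inC ∷ v) f g f≈g = begin
    sum (map t (concatMap (λ S → (outside ∷ S) ∷ (inside ∷ S) ∷ []) Ss))
      ≈⟨ sum-subsets-cons Ss t ⟩
    sum (map (t ∘ (inside ∷_)) Ss) + sum (map (t ∘ (outside ∷_)) Ss)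
      ≈⟨ +-cong
           (trans (sum-cong Ss (λ S → trans (*-congʳ (signPow-suc ∣ S ∣)) (*-assoc _ _ _)))
           (trans (sum-* Ss ε _) (*-congˡ
             (Exp-ωʳ (ρ ∘ Fin.suc) v (λ P Q → f (inside ∷ P) (outside ∷ Q)) (g ∘ ((ρ 0F , 0F) ∷_)) (f≈g ∘ (0F ∷_))))))
           (trans (Exp-ωʳ (ρ ∘ Fin.suc) v (λ P Q → f (outside ∷ P) (inside ∷ Q)) (g ∘ ((ρ 0F , 1F) ∷_)) (f≈g ∘ (1F ∷_)))
             (sym (*-identityˡ _))) ⟩
    ε * Exp ωʳ (labelled (ρ ∘ Fin.suc) v) (g ∘ ((ρ 0F , 0F) ∷_)) +
    1# * Exp ωʳ (labelled (ρ ∘ Fin.suc) v) (g ∘ ((ρ 0F , 1F) ∷_))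
      ∎
    where
    Ss = subsetsOf (region inC v)
    t : Subset _ → Carrier
    t S = signPow ∣ S ∣ * f (region inA (inC ∷ v) ∪ S) (region inB (inC ∷ v) ∪ (region inC (inC ∷ v) ─ S))

  exchange : ∀ r (v : Vec Label n) → ∣ region inC v ∣ ≡ r →
    jellyfish M r (region inA v ∪ region inB v ∷ region inC v ∷ []) ≈
    sum (map (λ S → signPow ∣ S ∣ * jellyfish M r (region inA v ∪ S ∷ region inB v ∪ (region inC v ─ S) ∷ []))
             (subsetsOf (region inC v)))
  exchange r v ∣C∣≡r = begin
    jellyfish M r (region inA v ∪ region inB v ∷ region inC v ∷ [])
      ≡⟨ ≡.cong₂ (λ P Q → jellyfish M r (P ∷ Q ∷ [])) (block₀-side v) (block₁-side v) ⟩
    jellyfish M r (block 0F u ∷ block 1F u ∷ [])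
      ≈⟨ jellyfish-Z r r≤n u ⟩
    Z δ top low (labelled id u)
      ≈⟨ Exp-ωˡ id v _ ⟨
    Exp ωˡ w (Z δ top low)
      ≈⟨ Exp-Z ωˡ top low w ⟩
    Z ωˡ top low w
      -- Here the size of `C` enters: it equals the number of top rows.
      ≈⟨ Z-agree top low w (≡.trans (countC-labelled id v) (≡.trans ∣C∣≡r (≡.sym (length-rowsBelow r r≤n)))) ⟩
    Z ωʳ top low w
      ≈⟨ Exp-Z ωʳ top low w ⟨
    Exp ωʳ w (Z δ top low)
      ≈⟨ Exp-ωʳ id v (λ P Q → jellyfish M r (P ∷ Q ∷ [])) _ (jellyfish-Z r r≤n) ⟨
    sum (map _ (subsetsOf (region inC v)))
      ∎
    where
    r≤n : r ℕ.≤ n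
    r≤n = ≡.subst (ℕ._≤ n) ∣C∣≡r (∣p∣≤n (region inC v))
    u   = Vec.map side v
    w   = labelled id v
    -- The rows depend only on `n` and `r`, so the same lists serve every partition in the identity.
    top = rowsBelow r
    low = rowsBetween r (n ℕ.∸ (1 ℕ.* r))

theorem5p5 : ∀ {c ℓ : Level} (R : CommutativeRing c ℓ) (n r : ℕ) → n ≥ 1 → r ≥ 1 →
    (M : Fin n → Fin n → CommutativeRing.Carrier R) →
    (A B C : Subset n) → Nonempty A → Nonempty B → Nonempty C →
    A ∩ B ≡ ⊥ → A ∩ C ≡ ⊥ → B ∩ C ≡ ⊥ → A ∪ B ∪ C ≡ ⊤ → ∣ C ∣ ≡ r →
    CommutativeRing._≈_ R
    (Jelly.jellyfish R M r (A ∪ B ∷ C ∷ []))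
    (Jelly.sum R (map (λ S → CommutativeRing._*_ R (Jelly.signPow R ∣ S ∣)
    (Jelly.jellyfish R M r (A ∪ S ∷ B ∪ (C ─ S) ∷ [])))
    (subsetsOf C)))
theorem5p5 R n r _ _ M A B C _ _ _ AB AC BC ABC ∣C∣≡r with labelling A B C AB AC BC ABC
... | v , ≡.refl , ≡.refl , ≡.refl = Exchange.exchange R M r v ∣C∣≡r
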